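{- Let $N\ge 1$, $T\ge 1$ and $0\le S\le T-1$ be integers. The matrix $P^S_{S\mapsto S+1}$ with rows indexed by $\Omega(N,T,S)$ and columns indexed by $\Omega(N,T,S+1)$ (defined in the context) is stochastic, i.e. its entries are nonnegative and $\sum_{Y\in\Omega(N,T,S+1)}P^S_{S\mapsto S+1}(X,Y)=1$ for every $X\in\Omega(N,T,S)$. Moreover it maps the uniform measure to the uniform measure: for every $Y\in\Omega(N,T,S+1)$, $$\mu(N,T,S+1)(Y)=\sum_{X\in\Omega(N,T,S)}P^S_{S\mapsto S+1}(X,Y)\,\mu(N,T,S)(X).$$
   Context: Fix integers $N\ge1$, $T\ge1$. For an integer $0\le S\le T$, $\Omega(N,T,S)$ is the set of families of $N$ non-intersecting lattice paths $\tau_1,\dots,\tau_N:\{0,1,\dots,T\}\to\mathbb Z$ with $\tau_i(0)=i-1$, $\tau_i(T)=S+i-1$, $\tau_i(t+1)-\tau_i(t)\in\{0,1\}$ and $\tau_1(t)<\dots<\tau_N(t)$ for all $t$. Such a family is identified with the sequence $X=(X(0),X(1),\dots,X(T))$, $X(t)=(\tau_1(t),\dots,\tau_N(t))$. $\mu(N,T,S)$ is the uniform probability measure on $\Omega(N,T,S)$. For $0\le S,t\le T$ put $$\mathfrak X^{S,t}=\{x\in\mathbb Z:\max(0,t+S-T)\le x\le\min(t+N-1,S+N-1)\},$$ $$\mathcal X^{S,t}=\{(x_1,\dots,x_N)\in(\mathfrak X^{S,t})^N: x_1<\dots<x_N\};$$ then $X(t)\in\mathcal X^{S,t}$ for $X\in\Omega(N,T,S)$.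 $(a)_k=a(a+1)\cdots(a+k-1)$. Matrix $P^{S,t}_{t+}$ ($0\le t\le T-1$), of size $|\mathcal X^{S,t}|\times|\mathcal X^{S,t+1}|$: $$P^{S,t}_{t+}(X,Y)=\frac{\prod_{i<j}(y_j-y_i)\prod_{i:y_i=x_i+1}(N+S-x_i-1)\prod_{i:y_i=x_i}(x_i+T-t-S)}{(T-t)_N\prod_{i<j}(x_j-x_i)}$$ if $y_i-x_i\in\{0,1\}$ for all $i$, and $0$ otherwise. Matrix $P^{S,t}_{S- }$ ($1\le S\le T$), of size $|\mathcal X^{S,t}|\times|\mathcal X^{S-1,t}|$: $$P^{S,t}_{S- }(X,Y)=\frac{\prod_{i<j}(y_j-y_i)\prod_{i:y_i=x_i-1}x_i\prod_{i:y_i=x_i}(S+N-1-x_i)}{(S)_N\prod_{i<j}(x_j-x_i)}$$ if $y_i-x_i\in\{ -1,0\}$ for all $i$, and $0$ otherwise. For $0\le S\le T-1$, $X\in\Omega(N,T,S)$, $Y\in\Omega(N,T,S+1)$ define $$P^S_{S\mapsto S+1}(X,Y)=\prod_{t=0}^{T-1}\frac{P^{S+1,t}_{t+}(Y(t),Y(t+1))\,P^{S+1,t+1}_{S- }(Y(t+1),X(t+1))}{(P^{S+1,t}_{t+}P^{S+1,t+1}_{S- })(Y(t),X(t+1))}$$ if $\prod_{t=0}^{T-1}(P^{S+1,t}_{t+}P^{S+1,t+1}_{S- })(Y(t),X(t+1))>0$, and $P^S_{S\mapsto S+1}(X,Y)=0$ otherwise. (Juxtaposition of matrices is the matrix product.)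 -}

module Defs where

open import Data.Bool.Base using (if_then_else_)
open import Data.Fin.Base as Fin using (Fin; zero; suc; toℕ; fromℕ; inject₁)
import Data.Fin.Properties as Fin
open import Data.Integer.Base as ℤ using (ℤ; +_)
import Data.Integer.Properties as ℤ
open import Data.List.Base as List using (List; []; _∷_; cartesianProductWith; filter; foldr; length; map; upTo)
open import Data.List.Membership.Propositional using (_∈_)
open import Data.List.Membership.Propositional.Properties using (∈-cartesianProductWith⁺; ∈-filter⁺; ∈-filter⁻; ∈-map⁺; ∈-upTo⁺)
open import Data.List.Relation.Unary.All using ([])
open import Data.List.Relation.Unary.Any using (here)
open import Data.List.Relation.Unary.AllPairs using ([]; _∷_)
open import Data.List.Relation.Unary.Unique.Propositional using (Unique)
import Data.List.Relation.Unary.Unique.Propositional.Properties as Unique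
open import Data.Nat.Base as ℕ using (ℕ; zero; suc)
import Data.Nat.Properties as ℕ
open import Data.Product.Base using (_×_; _,_; proj₁; proj₂)
open import Data.Rational.Base as ℚ using (ℚ; 0ℚ; 1ℚ)
import Data.Rational.Properties as ℚ
open import Data.Sum.Base using (_⊎_; inj₁; inj₂)
open import Data.Vec.Base using (Vec; []; _∷_; lookup)
open import Data.Vec.Properties using (∷-injective)
open import Function.Base using (_∘_)
open import Relation.Binary.PropositionalEquality using (_≡_; refl; sym; trans; cong; subst)
open import Relation.Nullary.Decidable using (Dec; yes; no; does; map′; _×-dec_; _⊎-dec_; _→-dec_)
open import Relation.Unary using (Decidable)

import Algebra.Properties.CommutativeMonoid.Sum ℤ.*-1-commutativeMonoid as ℤ∏
import Algebra.Properties.CommutativeMonoid.Sum ℚ.*-1-commutativeMonoid as ℚ∏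

∏ℤ : ∀ {n} → (Fin n → ℤ) → ℤ
∏ℤ = ℤ∏.sum

∏ℚ : ∀ {n} → (Fin n → ℚ) → ℚ
∏ℚ = ℚ∏.sum

-- Sum of f over a finite set, given as a list of its elements.
∑ : ∀ {A : Set} → List A → (A → ℚ) → ℚ
∑ xs f = foldr ℚ._+_ 0ℚ (map f xs)

fromℤ : ℤ → ℚ
fromℤ n = n ℚ./ 1

-- Division made total by p /₀ 0 = 0.  For X in the row index set, the
-- denominators of P-t+ (t < T) and P-S- (1 ≤ S ≤ T) are nonzero, |Ω N T S| is
-- nonzero for S ≤ T, and P-S↦S+1 divides only when its denominators have a
-- positive product; so the convention is never used for these parameters.
infixl 7 _/₀_
_/₀_ : ℚ → ℚ → ℚ
p /₀ q with q ℚ.≟ 0ℚ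
... | yes _   = 0ℚ
... | no q≢0 = (p ℚ.÷ q) {{ℚ.≢-nonZero q≢0}}

-- poch a k = a (a + 1) ⋯ (a + k - 1)
poch : ℤ → ℕ → ℤ
poch a k = ∏ℤ {k} λ i → a ℤ.+ + toℕ i

Config : ℕ → Set
Config N = Vec ℤ N

-- The entry at t is X(t) = (τ₁(t), …, τ_N(t)); the path τᵢ of the text has
-- index i - 1 in Fin N.
Family : ℕ → ℕ → Set
Family N T = Vec (Config N) (suc T)

Increasing : ∀ {N} → Config N → Set
Increasing {N} x = ∀ (i j : Fin N) → i Fin.< j → lookup x i ℤ.< lookup x j

increasing? : ∀ {N} → Decidable (Increasing {N})
increasing? x = Fin.all? λ i → Fin.all? λ j → (i Fin.<? j) →-dec (lookup x i ℤ.<? lookup x j)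

module _ (N T S : ℕ) where

  In𝔛 : ℕ → ℤ → Set
  In𝔛 t x =
    (+ 0 ℤ.⊔ (+ t ℤ.+ + S ℤ.- + T) ℤ.≤ x) ×
    (x ℤ.≤ (+ t ℤ.+ + N ℤ.- + 1) ℤ.⊓ (+ S ℤ.+ + N ℤ.- + 1))

  In𝒳 : ℕ → Config N → Set
  In𝒳 t x = (∀ i → In𝔛 t (lookup x i)) × Increasing x

  in𝒳? : ∀ t → Decidable (In𝒳 t)
  in𝒳? t x = (Fin.all? λ i → (_ ℤ.≤? _) ×-dec (_ ℤ.≤? _)) ×-dec increasing? x

  record InΩ (X : Family N T) : Set where
    constructor mkInΩ
    field
      start      : ∀ i → lookup (lookup X zero) i ≡ + toℕ i
      end        : ∀ i → lookup (lookup X (fromℕ T)) i ≡ + S ℤ.+ + toℕ i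
      step       : ∀ (t : Fin T) i →
                   let δ = lookup (lookup X (suc t)) i ℤ.- lookup (lookup X (inject₁ t)) i
                   in δ ≡ + 0 ⊎ δ ≡ + 1
      increasing : ∀ t → Increasing (lookup X t)

  inΩ? : Decidable InΩ
  inΩ? X = map′ (λ (a , b , c , d) → mkInΩ a b c d) (λ (mkInΩ a b c d) → a , b , c , d)
    ( (Fin.all? λ _ → _ ℤ.≟ _)
    ×-dec (Fin.all? λ _ → _ ℤ.≟ _)
    ×-dec (Fin.all? λ _ → Fin.all? λ _ → (_ ℤ.≟ _) ⊎-dec (_ ℤ.≟ _))
    ×-dec (Fin.all? λ t → increasing? (lookup X t)))

allVecs : ∀ {A : Set} → List A → ∀ n → List (Vec A n)
allVecs as zero    = [] ∷ []
allVecs as (suc n) = cartesianProductWith _∷_ as (allVecs as n)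

-- The integers 0, …, S + N - 1, among which lie all coordinates of elements
-- of 𝒳 and Ω.
window : ℕ → ℕ → List ℤ
window N S = map +_ (upTo (S ℕ.+ N))

-- Duplicate-free enumerations of In𝒳 and InΩ; see ∈𝒳⁺, ∈𝒳⁻, 𝒳-unique and
-- ∈Ω⁺, ∈Ω⁻, Ω-unique below.
𝒳 : ∀ (N T S t : ℕ) → List (Config N)
𝒳 N T S t = filter (in𝒳? N T S t) (allVecs (window N S) N)

Ω : ∀ (N T S : ℕ) → List (Family N T)
Ω N T S = filter (inΩ? N T S) (allVecs (allVecs (window N S) N) (suc T))

μ : ∀ (N T S : ℕ) → Family N T → ℚ
μ N T S X = if does (inΩ? N T S X) then 1ℚ /₀ fromℤ (+ length (Ω N T S)) else 0ℚ

-- ∏_{i<j} (xⱼ - xᵢ)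
Δ : ∀ {N} → Config N → ℤ
Δ x = ∏ℤ λ i → ∏ℤ λ j → if does (i Fin.<? j) then lookup x j ℤ.- lookup x i else + 1

-- Matrices indexed by 𝒳 or Ω are given as functions on all configurations or
-- families; only their entries on the index sets matter.
Matrix : Set → Set → Set
Matrix A B = A → B → ℚ

infixl 7 _⟨_⟩_
_⟨_⟩_ : ∀ {A B C : Set} → Matrix A B → List B → Matrix B C → Matrix A C
(P ⟨ bs ⟩ Q) a c = ∑ bs λ b → P a b ℚ.* Q b c

P-t+ : ∀ (N T S t : ℕ) → Matrix (Config N) (Config N)
P-t+ N T S t X Y =
  if does (Fin.all? λ i → (y i ℤ.- x i ℤ.≟ + 0) ⊎-dec (y i ℤ.- x i ℤ.≟ + 1))
  then fromℤ ( Δ Y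
         ℤ.* ∏ℤ (λ i → if does (y i ℤ.≟ x i ℤ.+ + 1) then + N ℤ.+ + S ℤ.- x i ℤ.- + 1 else + 1)
         ℤ.* ∏ℤ (λ i → if does (y i ℤ.≟ x i) then x i ℤ.+ + T ℤ.- + t ℤ.- + S else + 1))
       /₀ fromℤ (poch (+ T ℤ.- + t) N ℤ.* Δ X)
  else 0ℚ
  where
  x y : Fin N → ℤ
  x = lookup X
  y = lookup Y

P-S- : ∀ (N T S t : ℕ) → Matrix (Config N) (Config N)
P-S- N T S t X Y =
  if does (Fin.all? λ i → (y i ℤ.- x i ℤ.≟ ℤ.- + 1) ⊎-dec (y i ℤ.- x i ℤ.≟ + 0))
  then fromℤ ( Δ Y
         ℤ.* ∏ℤ (λ i → if does (y i ℤ.≟ x i ℤ.- + 1) then x i else + 1)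
         ℤ.* ∏ℤ (λ i → if does (y i ℤ.≟ x i) then + S ℤ.+ + N ℤ.- + 1 ℤ.- x i else + 1))
       /₀ fromℤ (poch (+ S) N ℤ.* Δ X)
  else 0ℚ
  where
  x y : Fin N → ℤ
  x = lookup X
  y = lookup Y

P-S↦S+1 : ∀ (N T S : ℕ) → Matrix (Family N T) (Family N T)
P-S↦S+1 N T S X Y =
  if does (0ℚ ℚ.<? ∏ℚ denominator)
  then ∏ℚ (λ t → numerator t /₀ denominator t)
  else 0ℚ
  where
  P₁ P₂ : Fin T → Matrix (Config N) (Config N)
  P₁ t = P-t+ N T (suc S) (toℕ t)
  P₂ t = P-S- N T (suc S) (suc (toℕ t))

  numerator denominator : Fin T → ℚ
  numerator t =
    P₁ t (lookup Y (inject₁ t)) (lookup Y (suc t)) ℚ.* P₂ t (lookup Y (suc t)) (lookup X (suc t))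
  denominator t =
    (P₁ t ⟨ 𝒳 N T (suc S) (suc (toℕ t)) ⟩ P₂ t) (lookup Y (inject₁ t)) (lookup X (suc t))

allVecs-complete : ∀ {A : Set} {as : List A} {n} (v : Vec A n) →
                   (∀ i → lookup v i ∈ as) → v ∈ allVecs as n
allVecs-complete []      _ = here refl
allVecs-complete (x ∷ v) h =
  ∈-cartesianProductWith⁺ _∷_ (h zero) (allVecs-complete v (h ∘ suc))

allVecs-unique : ∀ {A : Set} {as : List A} → Unique as → ∀ n → Unique (allVecs as n)
allVecs-unique u zero    = [] ∷ []
allVecs-unique u (suc n) = Unique.cartesianProductWith⁺ _∷_ ∷-injective u (allVecs-unique u n)

window-unique : ∀ N S → Unique (window N S)
window-unique N S = Unique.map⁺ ℤ.+-injective (Unique.upTo⁺ (S ℕ.+ N))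

∈-window : ∀ N S {z} → + 0 ℤ.≤ z → z ℤ.< + S ℤ.+ + N → z ∈ window N S
∈-window N S {+ n} _ (ℤ.+<+ n<) = ∈-map⁺ +_ (∈-upTo⁺ n<)

𝒳-unique : ∀ N T S t → Unique (𝒳 N T S t)
𝒳-unique N T S t = Unique.filter⁺ (in𝒳? N T S t) (allVecs-unique (window-unique N S) N)

Ω-unique : ∀ N T S → Unique (Ω N T S)
Ω-unique N T S = Unique.filter⁺ (inΩ? N T S)
  (allVecs-unique (allVecs-unique (window-unique N S) N) (suc T))

∈𝒳⁻ : ∀ N T S t {x} → x ∈ 𝒳 N T S t → In𝒳 N T S t x
∈𝒳⁻ N T S t x∈ = proj₂ (∈-filter⁻ (in𝒳? N T S t) {xs = allVecs (window N S) N} x∈)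

∈Ω⁻ : ∀ N T S {X} → X ∈ Ω N T S → InΩ N T S X
∈Ω⁻ N T S X∈ =
  proj₂ (∈-filter⁻ (inΩ? N T S) {xs = allVecs (allVecs (window N S) N) (suc T)} X∈)

∈𝒳⁺ : ∀ N T S t {x} → In𝒳 N T S t x → x ∈ 𝒳 N T S t
∈𝒳⁺ N T S t {x} p@(bounds , _) = ∈-filter⁺ (in𝒳? N T S t) (allVecs-complete x in-window) p
  where
  pred< : ∀ a → a ℤ.- + 1 ℤ.< a
  pred< a = subst (a ℤ.- + 1 ℤ.<_) (ℤ.+-identityʳ a) (ℤ.+-monoʳ-< a ℤ.-<+)

  in-window : ∀ i → lookup x i ∈ window N S
  in-window i = ∈-window N S
    (ℤ.≤-trans (ℤ.i≤i⊔j _ _) (proj₁ (bounds i)))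
    (ℤ.≤-<-trans (ℤ.≤-trans (proj₂ (bounds i)) (ℤ.i⊓j≤j (+ t ℤ.+ + N ℤ.- + 1) _))
                 (pred< (+ S ℤ.+ + N)))

monotone-bounds : ∀ {n} (f : Fin (suc n) → ℤ) → (∀ t → f (inject₁ t) ℤ.≤ f (suc t)) →
                  ∀ t → f zero ℤ.≤ f t × f t ℤ.≤ f (fromℕ n)
monotone-bounds {zero}  f mono zero    = ℤ.≤-refl , ℤ.≤-refl
monotone-bounds {suc n} f mono zero    =
  ℤ.≤-refl , ℤ.≤-trans (mono zero) (proj₂ (monotone-bounds (f ∘ suc) (mono ∘ suc) zero))
monotone-bounds {suc n} f mono (suc t) with monotone-bounds (f ∘ suc) (mono ∘ suc) t
... | l , u = ℤ.≤-trans (mono zero) l , u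

∈Ω⁺ : ∀ N T S {X} → InΩ N T S X → X ∈ Ω N T S
∈Ω⁺ N T S {X} p = ∈-filter⁺ (inΩ? N T S)
  (allVecs-complete X λ t → allVecs-complete (lookup X t) (in-window t)) p
  where
  open InΩ p

  τ : Fin N → Fin (suc T) → ℤ
  τ i t = lookup (lookup X t) i

  nonneg : ∀ t i → + 0 ℤ.≤ τ i (suc t) ℤ.- τ i (inject₁ t)
  nonneg t i with step t i
  ... | inj₁ δ≡0 = ℤ.≤-reflexive (sym δ≡0)
  ... | inj₂ δ≡1 = subst (+ 0 ℤ.≤_) (sym δ≡1) (ℤ.+≤+ ℕ.z≤n)

  bounds : ∀ i t → τ i zero ℤ.≤ τ i t × τ i t ℤ.≤ τ i (fromℕ T)
  bounds i = monotone-bounds (τ i) (λ t → ℤ.0≤i-j⇒j≤i (nonneg t i))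

  in-window : ∀ t i → τ i t ∈ window N S
  in-window t i = ∈-window N S
    (ℤ.≤-trans (subst (+ 0 ℤ.≤_) (sym (start i)) (ℤ.+≤+ ℕ.z≤n)) (proj₁ (bounds i t)))
    (ℤ.≤-<-trans (proj₂ (bounds i t))
      (subst (ℤ._< + S ℤ.+ + N) (sym (end i)) (ℤ.+<+ (ℕ.+-monoʳ-< S (Fin.toℕ<n i)))))

{-# OPTIONS --safe #-}
module Submission where

-- After normalisation P-t+ and P-S- have entries const · Δ(y)/Δ(x) · ∏ᵢ w(xᵢ, yᵢ).
-- In P-t+ P-S- and in P-S- P-t+ the Δ of the intermediate configuration cancels,
-- and both become sums over increasing y of a product of one-particle weights, yᵢ
-- ranging over two neighbouring points.  Such a sum satisfies a two-term recurrence
-- whose coefficients are the one-particle totals and the weights of coincidences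
-- of neighbours; these agree for the two orders, so the two products commute.
--
-- Commutation makes the denominators of P-S↦S+1 positive along the supports, and
-- the row sum telescopes from t = T down to 0.  For a column one uses that
-- ∏ₜ P-t+(X(t), X(t+1)) does not depend on the family X (P-t+ is a Doob transform of
-- the step relation), which turns the sum over X into a telescoping one
-- from t = 0 up to T.  So all column sums are equal; counting the total mass by
-- rows and by columns identifies their value as |Ω(N,T,S)| / |Ω(N,T,S+1)|.

open import Defs
open import Data.Bool.Base using (if_then_else_; true; false)
open import Data.Fin.Base as Fin using (Fin; zero; suc; toℕ; fromℕ; inject₁)
import Data.Fin.Properties as Fin
open import Data.Integer.Base as ℤ using (ℤ; +_)
import Data.Integer.Properties as ℤ
open import Data.Integer.Tactic.RingSolver using (solve-∀)
open import Data.List.Base using (List; []; _∷_; _++_; cartesianProductWith; filter; map; length)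
open import Data.List.Membership.Propositional using (_∈_; _∉_)
open import Data.List.Membership.Propositional.Properties using (∈-cartesianProductWith⁺; ∈-cartesianProductWith⁻)
open import Data.List.Relation.Unary.All as All using ([]; _∷_)
open import Data.List.Relation.Unary.AllPairs using ([]; _∷_)
open import Data.List.Relation.Unary.Any using (here; there)
open import Data.List.Relation.Unary.Unique.Propositional using (Unique)
import Data.List.Relation.Unary.Unique.Propositional.Properties as Unique
open import Data.Nat.Base as ℕ using (ℕ; zero; suc; _≤_; _<_; _!)
open import Data.Nat.Coprimality using (1-coprimeTo) renaming (sym to coprime-sym)
import Data.Nat.Properties as ℕ
open import Data.Product.Base using (_×_; _,_; proj₁; proj₂)
open import Data.Rational.Base as ℚ using (ℚ; 0ℚ; 1ℚ; mkℚ; *<*; _+_; _*_; -_) renaming (_≤_ to _≤ℚ_)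
import Data.Rational.Properties as ℚ
import Data.Rational.Solver
open Data.Rational.Solver.+-*-Solver using (solve; _:=_; _:+_; _:*_; :-_)
open import Data.Sum.Base using (_⊎_; inj₁; inj₂; swap; map₂)
open import Data.Vec.Base using (Vec; []; _∷_; lookup; tabulate)
open import Data.Vec.Functional using (tail)
import Data.Vec.Properties as Vec
open import Function.Base using (_∘_; case_of_)
open import Relation.Binary.Definitions using (DecidableEquality)
open import Relation.Binary.PropositionalEquality
open import Relation.Nullary using (¬_; contradiction; Dec; yes; no; does; _⊎-dec_)
open import Relation.Unary using (Decidable)
import Algebra.Properties.CommutativeMonoid.Sum ℤ.*-1-commutativeMonoid as ℤ∏
import Algebra.Properties.CommutativeMonoid.Sum ℚ.*-1-commutativeMonoid as ℚ∏

-- Arithmetic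

-- The two products sum over different sets: from x the intermediate coordinates lie in {xᵢ, xᵢ + 1}
-- when `P-t+` acts first and in {xᵢ - 1, xᵢ} when `P-S-` does, so they are compared through the
-- recurrence and not term by term. It closes because two-point ranges based at an increasing
-- configuration meet only for neighbours, and then in one point. The window 𝔛 adds no constraint to
-- these sums: nonzero weights never leave it. A denominator is the product in one order. For a row,
-- X(t) is an explicit intermediate for the other order; for a column, Y(t + 1) is one for the given
-- order. So both summations carry the same invariant: the `P-S-` entry from Y(t) to X(t) is
-- nonzero. For a column, multiplying the entry by the constant ∏ₜ P-t+(X(t), X(t+1)) and by the
-- `P-S-` entry at time 0 completes the `P-S-` entries at times 1, ..., T to all of 0, ..., T.
-- Splitting off the last one instead of the first leaves a kernel that runs backwards in time,
-- normalised by the same denominators thanks to commutation. The constants produced on the way stay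
-- unevaluated positive numbers.

>⇒≢0 : ∀ {p} → 0ℚ ℚ.< p → p ≢ 0ℚ
>⇒≢0 0<p p≡0 = ℚ.<⇒≢ 0<p (sym p≡0)

≥∧≢0⇒> : ∀ {p} → 0ℚ ℚ.≤ p → p ≢ 0ℚ → 0ℚ ℚ.< p
≥∧≢0⇒> {p} 0≤p p≢0 with 0ℚ ℚ.<? p
... | yes 0<p = 0<p
... | no 0≮p = contradiction (ℚ.≤-antisym (ℚ.≮⇒≥ 0≮p) 0≤p) p≢0

*-pos : ∀ {p q} → 0ℚ ℚ.< p → 0ℚ ℚ.< q → 0ℚ ℚ.< p * q
*-pos {p} {q} 0<p 0<q = ℚ.positive⁻¹ (p * q)
  {{ℚ.pos*pos⇒pos p {{ℚ.positive 0<p}} q {{ℚ.positive 0<q}}}}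

*-nonneg : ∀ {p q} → 0ℚ ℚ.≤ p → 0ℚ ℚ.≤ q → 0ℚ ℚ.≤ p * q
*-nonneg {p} {q} 0≤p 0≤q = ℚ.nonNegative⁻¹ (p * q)
  {{ℚ.nonNeg*nonNeg⇒nonNeg p {{ℚ.nonNegative 0≤p}} q {{ℚ.nonNegative 0≤q}}}}

inv : ℚ → ℚ
inv q = 1ℚ /₀ q

-- Both sides are 0 at q = 0, so a quotient can be treated as a product without a side condition.
/₀≡*inv : ∀ p q → p /₀ q ≡ p * inv q
/₀≡*inv p q with q ℚ.≟ 0ℚ
... | yes _ = sym (ℚ.*-zeroʳ p)
... | no _  = cong (p *_) (sym (ℚ.*-identityˡ _))

*-inv : ∀ {q} → q ≢ 0ℚ → q * inv q ≡ 1ℚ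
*-inv {q} q≢0 with q ℚ.≟ 0ℚ
... | yes q≡0 = contradiction q≡0 q≢0
... | no q≢0  = trans (cong (q *_) (ℚ.*-identityˡ _)) (ℚ.*-inverseʳ q {{ℚ.≢-nonZero q≢0}})

inv-pos : ∀ {q} → 0ℚ ℚ.< q → 0ℚ ℚ.< inv q
inv-pos {q} 0<q with 0ℚ ℚ.<? inv q
... | yes h = h
... | no h  = contradiction refl (ℚ.<⇒≢ (ℚ.<-≤-trans (ℚ.positive⁻¹ 1ℚ) 1≤0))
  where
  1≤0 : 1ℚ ℚ.≤ 0ℚ
  1≤0 = subst₂ ℚ._≤_ (*-inv (>⇒≢0 0<q)) (ℚ.*-zeroʳ q)
    (ℚ.*-monoˡ-≤-nonNeg q {{ℚ.nonNegative (ℚ.<⇒≤ 0<q)}} (ℚ.≮⇒≥ h))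

inv-nonneg : ∀ {q} → 0ℚ ℚ.≤ q → 0ℚ ℚ.≤ inv q
inv-nonneg {q} 0≤q = case (q ℚ.≟ 0ℚ) of λ where
  (yes refl) → ℚ.≤-refl
  (no q≢0)   → ℚ.<⇒≤ (inv-pos (≥∧≢0⇒> 0≤q q≢0))

*-cancelˡ : ∀ {p q r} → p ≢ 0ℚ → p * q ≡ p * r → q ≡ r
*-cancelˡ {p} {q} {r} p≢0 eq = begin
  q                ≡⟨ ℚ.*-identityˡ q ⟨
  1ℚ * q           ≡⟨ cong (_* q) (*-inv p≢0) ⟨
  p * inv p * q    ≡⟨ lem p (inv p) q ⟩
  inv p * (p * q)  ≡⟨ cong (inv p *_) eq ⟩
  inv p * (p * r)  ≡⟨ lem p (inv p) r ⟨
  p * inv p * r    ≡⟨ cong (_* r) (*-inv p≢0) ⟩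
  1ℚ * r           ≡⟨ ℚ.*-identityˡ r ⟩
  r                ∎
  where
  open ≡-Reasoning
  lem : ∀ a b c → a * b * c ≡ b * (a * c)
  lem = solve 3 (λ a b c → a :* b :* c := b :* (a :* c)) refl

*-≢0 : ∀ {p q} → p ≢ 0ℚ → q ≢ 0ℚ → p * q ≢ 0ℚ
*-≢0 {p} p≢0 q≢0 pq≡0 = q≢0 (*-cancelˡ p≢0 (trans pq≡0 (sym (ℚ.*-zeroʳ p))))

-- The integers inside the rationals

-- For a variable n the quotient n / 1 is stuck on a gcd; in this normal form sums, products and
-- comparisons compute.
fromℤ-mkℚ : ∀ n → fromℤ n ≡ mkℚ n 0 (coprime-sym (1-coprimeTo _))
fromℤ-mkℚ n = ℚ.↥p/↧p≡p (mkℚ n 0 _)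

fromℤ-+ : ∀ m n → fromℤ (m ℤ.+ n) ≡ fromℤ m + fromℤ n
fromℤ-+ m n = sym (trans (cong₂ _+_ (fromℤ-mkℚ m) (fromℤ-mkℚ n))
  (cong fromℤ (cong₂ ℤ._+_ (ℤ.*-identityʳ m) (ℤ.*-identityʳ n))))

fromℤ-* : ∀ m n → fromℤ (m ℤ.* n) ≡ fromℤ m * fromℤ n
fromℤ-* m n = sym (cong₂ _*_ (fromℤ-mkℚ m) (fromℤ-mkℚ n))

fromℤ-pos : ∀ {n} → + 0 ℤ.< n → 0ℚ ℚ.< fromℤ n
fromℤ-pos {n} 0<n = subst (0ℚ ℚ.<_) (sym (fromℤ-mkℚ n))
  (*<* (subst (+ 0 ℤ.<_) (sym (ℤ.*-identityʳ n)) 0<n))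

-- Finite sums and products

∑-cong : ∀ {A : Set} (xs : List A) {f g : A → ℚ} →
         (∀ {x} → x ∈ xs → f x ≡ g x) → ∑ xs f ≡ ∑ xs g
∑-cong []       _  = refl
∑-cong (x ∷ xs) eq = cong₂ _+_ (eq (here refl)) (∑-cong xs (eq ∘ there))

∑-0 : ∀ {A : Set} (xs : List A) {f : A → ℚ} → (∀ {x} → x ∈ xs → f x ≡ 0ℚ) → ∑ xs f ≡ 0ℚ
∑-0 []       _  = refl
∑-0 (x ∷ xs) eq = cong₂ _+_ (eq (here refl)) (∑-0 xs (eq ∘ there))

∑-+ : ∀ {A : Set} (xs : List A) (f g : A → ℚ) → ∑ xs (λ x → f x + g x) ≡ ∑ xs f + ∑ xs g
∑-+ []       f g = refl
∑-+ (x ∷ xs) f g = trans (cong (λ s → f x + g x + s) (∑-+ xs f g))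
  (solve 4 (λ a b c d → (a :+ b) :+ (c :+ d) := (a :+ c) :+ (b :+ d)) refl (f x) (g x) (∑ xs f) (∑ xs g))

∑-*ˡ : ∀ {A : Set} (xs : List A) c (f : A → ℚ) → ∑ xs (λ x → c * f x) ≡ c * ∑ xs f
∑-*ˡ []       c f = sym (ℚ.*-zeroʳ c)
∑-*ˡ (x ∷ xs) c f = trans (cong (c * f x ℚ.+_) (∑-*ˡ xs c f)) (sym (ℚ.*-distribˡ-+ c (f x) (∑ xs f)))

∑-*ʳ : ∀ {A : Set} (xs : List A) c (f : A → ℚ) → ∑ xs (λ x → f x * c) ≡ ∑ xs f * c
∑-*ʳ xs c f = trans (∑-cong xs λ {x} _ → ℚ.*-comm (f x) c) (trans (∑-*ˡ xs c f) (ℚ.*-comm c (∑ xs f)))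

∑-swap : ∀ {A B : Set} (xs : List A) (ys : List B) (f : A → B → ℚ) →
         ∑ xs (λ x → ∑ ys (f x)) ≡ ∑ ys (λ y → ∑ xs (λ x → f x y))
∑-swap []       ys f = sym (∑-0 ys λ _ → refl)
∑-swap (x ∷ xs) ys f = trans (cong (∑ ys (f x) ℚ.+_) (∑-swap xs ys f)) (sym (∑-+ ys (f x) _))

∑-++ : ∀ {A : Set} (xs ys : List A) (f : A → ℚ) → ∑ (xs ++ ys) f ≡ ∑ xs f + ∑ ys f
∑-++ []       ys f = sym (ℚ.+-identityˡ _)
∑-++ (x ∷ xs) ys f = trans (cong (f x ℚ.+_) (∑-++ xs ys f)) (sym (ℚ.+-assoc (f x) (∑ xs f) (∑ ys f)))

∑-map : ∀ {A B : Set} (h : A → B) (xs : List A) (f : B → ℚ) → ∑ (map h xs) f ≡ ∑ xs (f ∘ h)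
∑-map h []       f = refl
∑-map h (x ∷ xs) f = cong (f (h x) ℚ.+_) (∑-map h xs f)

∑-cartesianProductWith : ∀ {A B C : Set} (h : A → B → C) (xs : List A) (ys : List B) (f : C → ℚ) →
  ∑ (cartesianProductWith h xs ys) f ≡ ∑ xs (λ x → ∑ ys (λ y → f (h x y)))
∑-cartesianProductWith h []       ys f = refl
∑-cartesianProductWith h (x ∷ xs) ys f =
  trans (∑-++ (map (h x) ys) _ f) (cong₂ _+_ (∑-map (h x) ys f) (∑-cartesianProductWith h xs ys f))

∑-filter : ∀ {A : Set} {P : A → Set} (P? : Decidable P) (xs : List A) (f : A → ℚ) →
           ∑ (filter P? xs) f ≡ ∑ xs (λ x → if does (P? x) then f x else 0ℚ)
∑-filter P? []       f = refl
∑-filter P? (x ∷ xs) f with does (P? x)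
... | true  = cong (f x ℚ.+_) (∑-filter P? xs f)
... | false = trans (∑-filter P? xs f) (sym (ℚ.+-identityˡ _))

∑-nonneg : ∀ {A : Set} (xs : List A) {f : A → ℚ} → (∀ {x} → x ∈ xs → 0ℚ ℚ.≤ f x) → 0ℚ ℚ.≤ ∑ xs f
∑-nonneg []       _ = ℚ.≤-refl
∑-nonneg (x ∷ xs) h = ℚ.+-mono-≤ (h (here refl)) (∑-nonneg xs (h ∘ there))

∑-pos : ∀ {A : Set} (xs : List A) {f : A → ℚ} {x} → (∀ {x} → x ∈ xs → 0ℚ ℚ.≤ f x) →
        x ∈ xs → 0ℚ ℚ.< f x → 0ℚ ℚ.< ∑ xs f
∑-pos (x ∷ xs) h (here refl) 0<fx = ℚ.+-mono-<-≤ 0<fx (∑-nonneg xs (h ∘ there))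
∑-pos (x ∷ xs) h (there x∈)  0<fx = ℚ.+-mono-≤-< (h (here refl)) (∑-pos xs (h ∘ there) x∈ 0<fx)

∑-1 : ∀ {A : Set} (xs : List A) → ∑ xs (λ _ → 1ℚ) ≡ fromℤ (+ length xs)
∑-1 []       = refl
∑-1 (x ∷ xs) = trans (cong (1ℚ ℚ.+_) (∑-1 xs)) (sym (fromℤ-+ (+ 1) (+ length xs)))

module _ {A : Set} (_≟_ : DecidableEquality A) where

  private
    δ : A → A → ℚ → ℚ
    δ x y c = if does (x ≟ y) then c else 0ℚ

  ∑-δ : ∀ {xs} → Unique xs → ∀ x {c} → (x ∉ xs → c ≡ 0ℚ) → ∑ xs (λ y → δ x y c) ≡ c
  ∑-δ []       x vanish = sym (vanish λ ())
  ∑-δ {y ∷ xs} (y∉ ∷ u) x {c} vanish with x ≟ y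
  ... | yes refl = trans (cong (c ℚ.+_) (∑-0 xs λ {z} z∈ → off z (All.lookup y∉ z∈))) (ℚ.+-identityʳ c)
    where
    off : ∀ z → x ≢ z → δ x z c ≡ 0ℚ
    off z x≢z with x ≟ z
    ... | yes x≡z = contradiction x≡z x≢z
    ... | no _    = refl
  ... | no x≢y = trans (ℚ.+-identityˡ _) (∑-δ u x λ x∉ → vanish λ { (here eq) → x≢y eq ; (there x∈) → x∉ x∈ })

  -- Expanding each side by `∑-δ` gives the same double sum over the diagonal of xs × ys. The
  -- vanishing hypotheses take care of the elements that occur in one list only.
  ∑-support : ∀ {xs ys} → Unique xs → Unique ys → (f : A → ℚ) →
              (∀ {x} → x ∈ xs → x ∉ ys → f x ≡ 0ℚ) → (∀ {y} → y ∈ ys → y ∉ xs → f y ≡ 0ℚ) →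
              ∑ xs f ≡ ∑ ys f
  ∑-support {xs} {ys} uxs uys f fx fy = begin
    ∑ xs f                             ≡⟨ ∑-cong xs (λ {x} x∈ → ∑-δ uys x (fx x∈)) ⟨
    ∑ xs (λ x → ∑ ys λ y → δ x y (f x)) ≡⟨ ∑-swap xs ys (λ x y → δ x y (f x)) ⟩
    ∑ ys (λ y → ∑ xs λ x → δ x y (f x)) ≡⟨ ∑-cong ys (λ {y} _ → ∑-cong xs λ {x} _ → flip x y) ⟩
    ∑ ys (λ y → ∑ xs λ x → δ y x (f y)) ≡⟨ ∑-cong ys (λ {y} y∈ → ∑-δ uxs y (fy y∈)) ⟩
    ∑ ys f                             ∎
    where
    open ≡-Reasoning
    flip : ∀ x y → δ x y (f x) ≡ δ y x (f y)
    flip x y with x ≟ y | y ≟ x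
    ... | yes refl | yes _   = refl
    ... | yes refl | no y≢x  = contradiction refl y≢x
    ... | no x≢y   | yes y≡x = contradiction (sym y≡x) x≢y
    ... | no _     | no _    = refl

∏ℚ-pos : ∀ {n} {f : Fin n → ℚ} → (∀ i → 0ℚ ℚ.< f i) → 0ℚ ℚ.< ∏ℚ f
∏ℚ-pos {zero}  _ = ℚ.positive⁻¹ 1ℚ
∏ℚ-pos {suc n} h = *-pos (h zero) (∏ℚ-pos (h ∘ suc))

∏ℚ-nonneg : ∀ {n} {f : Fin n → ℚ} → (∀ i → 0ℚ ℚ.≤ f i) → 0ℚ ℚ.≤ ∏ℚ f
∏ℚ-nonneg {zero}  _ = ℚ.<⇒≤ (ℚ.positive⁻¹ 1ℚ)
∏ℚ-nonneg {suc n} h = *-nonneg (h zero) (∏ℚ-nonneg (h ∘ suc))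

∏ℚ-0 : ∀ {n} {f : Fin n → ℚ} i → f i ≡ 0ℚ → ∏ℚ f ≡ 0ℚ
∏ℚ-0 {f = f} zero    eq = trans (cong (_* ∏ℚ (f ∘ suc)) eq) (ℚ.*-zeroˡ (∏ℚ (f ∘ suc)))
∏ℚ-0 {f = f} (suc i) eq = trans (cong (f zero *_) (∏ℚ-0 i eq)) (ℚ.*-zeroʳ (f zero))

∏ℤ-pos : ∀ {n} {f : Fin n → ℤ} → (∀ i → + 0 ℤ.< f i) → + 0 ℤ.< ∏ℤ f
∏ℤ-pos {zero}  _ = ℤ.+<+ (ℕ.s≤s ℕ.z≤n)
∏ℤ-pos {suc n} {f} h = subst (ℤ._< f zero ℤ.* ∏ℤ (f ∘ suc)) (ℤ.*-zeroʳ (f zero))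
  (ℤ.*-monoˡ-<-pos (f zero) {{ℤ.positive (h zero)}} (∏ℤ-pos (h ∘ suc)))

∏ℤ-0 : ∀ {n} {f : Fin n → ℤ} i → f i ≡ + 0 → ∏ℤ f ≡ + 0
∏ℤ-0 {f = f} zero    eq = trans (cong (ℤ._* ∏ℤ (f ∘ suc)) eq) (ℤ.*-zeroˡ (∏ℤ (f ∘ suc)))
∏ℤ-0 {f = f} (suc i) eq = trans (cong (f zero ℤ.*_) (∏ℤ-0 i eq)) (ℤ.*-zeroʳ (f zero))

fromℤ-∏ : ∀ {n} (f : Fin n → ℤ) → fromℤ (∏ℤ f) ≡ ∏ℚ (fromℤ ∘ f)
fromℤ-∏ {zero}  f = refl
fromℤ-∏ {suc n} f = trans (fromℤ-* (f zero) (∏ℤ (f ∘ suc))) (cong (fromℤ (f zero) *_) (fromℤ-∏ (f ∘ suc)))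

inv-* : ∀ {p q} → p ≢ 0ℚ → q ≢ 0ℚ → inv (p * q) ≡ inv p * inv q
inv-* {p} {q} p≢0 q≢0 = *-cancelˡ (*-≢0 p≢0 q≢0) (begin
  p * q * inv (p * q)          ≡⟨ *-inv (*-≢0 p≢0 q≢0) ⟩
  1ℚ                           ≡⟨ cong₂ _*_ (*-inv p≢0) (*-inv q≢0) ⟨
  (p * inv p) * (q * inv q)    ≡⟨ solve 4 (λ a b c d → (a :* b) :* (c :* d) := a :* c :* (b :* d)) refl p (inv p) q (inv q) ⟩
  p * q * (inv p * inv q)      ∎)
  where open ≡-Reasoning

resp-nonneg : ∀ {a b} → + 0 ℤ.≤ a → a ≡ b → + 0 ℤ.≤ b
resp-nonneg h eq = subst (+ 0 ℤ.≤_) eq h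

+-nonneg : ∀ {a b} → + 0 ℤ.≤ a → + 0 ℤ.≤ b → + 0 ℤ.≤ a ℤ.+ b
+-nonneg = ℤ.+-mono-≤

0≤1 : + 0 ℤ.≤ + 1
0≤1 = ℤ.+≤+ ℕ.z≤n

pos⇒pred-nonneg : ∀ {a} → + 0 ℤ.< a → + 0 ℤ.≤ a ℤ.- + 1
pos⇒pred-nonneg {+ suc n} _ = ℤ.+≤+ ℕ.z≤n
pos⇒pred-nonneg {+ zero} (ℤ.+<+ ())

pred-nonneg⇒pos : ∀ {a} → + 0 ℤ.≤ a ℤ.- + 1 → + 0 ℤ.< a
pred-nonneg⇒pos h = ℤ.suc[i]≤j⇒i<j (ℤ.0≤i-j⇒j≤i h)

<⇒0≤-pred : ∀ {a b} → a ℤ.< b → + 0 ℤ.≤ b ℤ.- a ℤ.- + 1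
<⇒0≤-pred {a} {b} a<b = resp-nonneg (ℤ.i≤j⇒0≤j-i (ℤ.i<j⇒suc[i]≤j a<b)) (lem a b)
  where
  lem : ∀ a b → b ℤ.- (+ 1 ℤ.+ a) ≡ b ℤ.- a ℤ.- + 1
  lem = solve-∀

0≤-pred⇒< : ∀ {a b} → + 0 ℤ.≤ b ℤ.- a ℤ.- + 1 → a ℤ.< b
0≤-pred⇒< {a} {b} h = ℤ.suc[i]≤j⇒i<j (ℤ.0≤i-j⇒j≤i (resp-nonneg h (lem a b)))
  where
  lem : ∀ a b → b ℤ.- a ℤ.- + 1 ≡ b ℤ.- (+ 1 ℤ.+ a)
  lem = solve-∀

i≢i+1 : ∀ {x} → x ≢ x ℤ.+ + 1
i≢i+1 {x} eq = ℤ.i≢suc[i] (trans eq (ℤ.+-comm x (+ 1)))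

i<i+1 : ∀ {x} → x ℤ.< x ℤ.+ + 1
i<i+1 {x} = ℤ.suc[i]≤j⇒i<j (ℤ.≤-reflexive (ℤ.+-comm (+ 1) x))

-- One-particle weights

two : (a b p q : ℤ) → ℤ → ℤ
two a b p q y = if does (y ℤ.≟ a) then p else if does (y ℤ.≟ b) then q else + 0

two-fst : ∀ {a b p q y} → y ≡ a → two a b p q y ≡ p
two-fst {a} {y = y} y≡a with y ℤ.≟ a
... | yes _  = refl
... | no y≢a = contradiction y≡a y≢a

two-snd : ∀ {a b p q y} → a ≢ b → y ≡ b → two a b p q y ≡ q
two-snd {a} {b} {y = y} a≢b y≡b with y ℤ.≟ a | y ℤ.≟ b
... | yes y≡a | _      = contradiction (trans (sym y≡a) y≡b) a≢b
... | no _    | yes _  = refl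
... | no _    | no y≢b = contradiction y≡b y≢b

two-off : ∀ {a b p q y} → y ≢ a → y ≢ b → two a b p q y ≡ + 0
two-off {a} {b} {y = y} y≢a y≢b with y ℤ.≟ a | y ℤ.≟ b
... | yes y≡a | _       = contradiction y≡a y≢a
... | no _    | yes y≡b = contradiction y≡b y≢b
... | no _    | no _    = refl

two-supp : ∀ {a b p q y} → two a b p q y ≢ + 0 → y ≡ a ⊎ y ≡ b
two-supp {a} {b} {p} {q} {y} ≢0 = case ((y ℤ.≟ a) , (y ℤ.≟ b)) of λ where
  (yes y≡a , _)      → inj₁ y≡a
  (_ , yes y≡b)      → inj₂ y≡b
  (no y≢a , no y≢b)  → contradiction (two-off {a} {b} {p} {q} y≢a y≢b) ≢0

-- Common normal form of `P-t+` and `P-S-`. If the guard holds, exactly one of the two factors at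
-- each i is the weight and the other is 1. If it fails at some i, the weight at that i is 0 and the
-- product vanishes, so the guard is absorbed.
guarded-∏ : ∀ {n} (a b p q y : Fin n → ℤ) → (∀ i → a i ≢ b i) →
  {G : Fin n → Set} (G? : Decidable G) (all-G? : Dec (∀ i → G i)) →
  (∀ {i} → G i → y i ≡ a i ⊎ y i ≡ b i) → (∀ {i} → y i ≡ a i ⊎ y i ≡ b i → G i) → ∀ c d →
  (if does all-G?
   then fromℤ (c ℤ.* ∏ℤ (λ i → if does (y i ℤ.≟ a i) then p i else + 1)
                 ℤ.* ∏ℤ (λ i → if does (y i ℤ.≟ b i) then q i else + 1)) /₀ d
   else 0ℚ)
  ≡ fromℤ c * fromℤ (∏ℤ λ i → two (a i) (b i) (p i) (q i) (y i)) * inv d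
guarded-∏ a b p q y a≢b {G} G? all-G? to from c d with all-G?
... | yes g = begin
  fromℤ (c ℤ.* ∏ℤ A ℤ.* ∏ℤ B) /₀ d    ≡⟨ /₀≡*inv _ d ⟩
  fromℤ (c ℤ.* ∏ℤ A ℤ.* ∏ℤ B) * inv d ≡⟨ cong (λ z → fromℤ z * inv d) (ℤ.*-assoc c (∏ℤ A) (∏ℤ B)) ⟩
  fromℤ (c ℤ.* (∏ℤ A ℤ.* ∏ℤ B)) * inv d
    ≡⟨ cong (λ z → fromℤ (c ℤ.* z) * inv d) (trans (sym (ℤ∏.∑-distrib-+ A B)) (ℤ∏.sum-cong-≗ pointwise)) ⟩
  fromℤ (c ℤ.* ∏ℤ W) * inv d          ≡⟨ cong (_* inv d) (fromℤ-* c (∏ℤ W)) ⟩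
  fromℤ c * fromℤ (∏ℤ W) * inv d      ∎
  where
  open ≡-Reasoning
  A B W : Fin _ → ℤ
  A i = if does (y i ℤ.≟ a i) then p i else + 1
  B i = if does (y i ℤ.≟ b i) then q i else + 1
  W i = two (a i) (b i) (p i) (q i) (y i)

  pointwise : ∀ i → A i ℤ.* B i ≡ W i
  pointwise i with y i ℤ.≟ a i | y i ℤ.≟ b i | to (g i)
  ... | yes y≡a | yes y≡b | _        = contradiction (trans (sym y≡a) y≡b) (a≢b i)
  ... | yes _   | no _    | _        = ℤ.*-identityʳ (p i)
  ... | no _    | yes _   | _        = ℤ.*-identityˡ (q i)
  ... | no y≢a  | no y≢b  | inj₁ y≡a = contradiction y≡a y≢a
  ... | no y≢a  | no y≢b  | inj₂ y≡b = contradiction y≡b y≢b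
... | no ¬g with Fin.¬∀⟶∃¬ _ G G? ¬g
...   | i , ¬Gi = sym (trans (cong (λ z → fromℤ c * fromℤ z * inv d) (∏ℤ-0 i off))
                    (trans (cong (_* inv d) (ℚ.*-zeroʳ (fromℤ c))) (ℚ.*-zeroˡ (inv d))))
  where
  off : two (a i) (b i) (p i) (q i) (y i) ≡ + 0
  off = two-off {a i} {b i} {p i} {q i} (¬Gi ∘ from ∘ inj₁) (¬Gi ∘ from ∘ inj₂)

w₁ : (N T S t : ℕ) → ℤ → ℤ → ℤ
w₁ N T S t x = two (x ℤ.+ + 1) x (+ N ℤ.+ + S ℤ.- x ℤ.- + 1) (x ℤ.+ + T ℤ.- + t ℤ.- + S)

w₂ : (N S : ℕ) → ℤ → ℤ → ℤ
w₂ N S x = two (x ℤ.- + 1) x x (+ S ℤ.+ + N ℤ.- + 1 ℤ.- x)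

W₁ : ∀ (N T S t : ℕ) → Config N → Config N → ℤ
W₁ N T S t x y = ∏ℤ λ i → w₁ N T S t (lookup x i) (lookup y i)

W₂ : ∀ (N S : ℕ) → Config N → Config N → ℤ
W₂ N S x y = ∏ℤ λ i → w₂ N S (lookup x i) (lookup y i)

i-1≢i : ∀ {x} → x ℤ.- + 1 ≢ x
i-1≢i {x} eq = i≢i+1 {x ℤ.- + 1} (trans eq (lem x))
  where
  lem : ∀ x → x ≡ x ℤ.- + 1 ℤ.+ + 1
  lem = solve-∀

i-j≡k⇒i≡j+k : ∀ i j {k} → i ℤ.- j ≡ k → i ≡ j ℤ.+ k
i-j≡k⇒i≡j+k i j refl = lem i j
  where
  lem : ∀ i j → i ≡ j ℤ.+ (i ℤ.- j)
  lem = solve-∀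

i≡j+k⇒i-j≡k : ∀ {i} j k → i ≡ j ℤ.+ k → i ℤ.- j ≡ k
i≡j+k⇒i-j≡k j k refl = lem j k
  where
  lem : ∀ j k → j ℤ.+ k ℤ.- j ≡ k
  lem = solve-∀

i-j≡0⇒i≡j : ∀ {i j} → i ℤ.- j ≡ + 0 → i ≡ j
i-j≡0⇒i≡j {i} {j} = ℤ.i-j≡0⇒i≡j i j

P-t+-W₁ : ∀ N T S t X Y →
  P-t+ N T S t X Y ≡ fromℤ (Δ Y) * fromℤ (W₁ N T S t X Y) * inv (fromℤ (poch (+ T ℤ.- + t) N ℤ.* Δ X))
P-t+-W₁ N T S t X Y = guarded-∏ _ _ _ _ y (λ i eq → i≢i+1 (sym eq)) G? (Fin.all? G?)
  (λ { {i} (inj₁ eq) → inj₂ (i-j≡0⇒i≡j eq) ; {i} (inj₂ eq) → inj₁ (i-j≡k⇒i≡j+k (y i) (x i) eq) })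
  (λ { {i} (inj₁ eq) → inj₂ (i≡j+k⇒i-j≡k (x i) _ eq) ; {i} (inj₂ eq) → inj₁ (ℤ.i≡j⇒i-j≡0 eq) })
  (Δ Y) (fromℤ (poch (+ T ℤ.- + t) N ℤ.* Δ X))
  where
  x y : Fin N → ℤ
  x = lookup X
  y = lookup Y

  G? : Decidable λ i → y i ℤ.- x i ≡ + 0 ⊎ y i ℤ.- x i ≡ + 1
  G? i = (y i ℤ.- x i ℤ.≟ + 0) ⊎-dec (y i ℤ.- x i ℤ.≟ + 1)

P-S--W₂ : ∀ N T S t X Y →
  P-S- N T S t X Y ≡ fromℤ (Δ Y) * fromℤ (W₂ N S X Y) * inv (fromℤ (poch (+ S) N ℤ.* Δ X))
P-S--W₂ N T S t X Y = guarded-∏ _ _ _ _ y (λ i → i-1≢i) G? (Fin.all? G?)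
  (λ { {i} (inj₁ eq) → inj₁ (i-j≡k⇒i≡j+k (y i) (x i) eq) ; {i} (inj₂ eq) → inj₂ (i-j≡0⇒i≡j eq) })
  (λ { {i} (inj₁ eq) → inj₁ (i≡j+k⇒i-j≡k (x i) _ eq) ; {i} (inj₂ eq) → inj₂ (ℤ.i≡j⇒i-j≡0 eq) })
  (Δ Y) (fromℤ (poch (+ S) N ℤ.* Δ X))
  where
  x y : Fin N → ℤ
  x = lookup X
  y = lookup Y

  G? : Decidable λ i → y i ℤ.- x i ≡ ℤ.- + 1 ⊎ y i ℤ.- x i ≡ + 0
  G? i = (y i ℤ.- x i ℤ.≟ ℤ.- + 1) ⊎-dec (y i ℤ.- x i ℤ.≟ + 0)

-- Sums over increasing configurations

zero* : ∀ {c} → c ≡ 0ℚ → ∀ x → c * x ≡ 0ℚ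
zero* refl = ℚ.*-zeroˡ

one* : ∀ {c} → c ≡ 1ℚ → ∀ x → c * x ≡ x
one* refl = ℚ.*-identityˡ

gate : ℤ → ℤ → ℚ
gate l y = if does (l ℤ.<? y) then 1ℚ else 0ℚ

gate-< : ∀ {l y} → l ℤ.< y → gate l y ≡ 1ℚ
gate-< {l} {y} l<y with l ℤ.<? y
... | yes _  = refl
... | no l≮y = contradiction l<y l≮y

gate-≮ : ∀ {l y} → ¬ l ℤ.< y → gate l y ≡ 0ℚ
gate-≮ {l} {y} l≮y with l ℤ.<? y
... | yes l<y = contradiction l<y l≮y
... | no _    = refl

-- The indicator of l < y₁ < ⋯ < yₙ in product form, so that a sum over increasing configurations
-- can be peeled off coordinate by coordinate, with yᵢ as the lower bound for the rest.
chain : ∀ {n} → ℤ → Vec ℤ n → ℚ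
chain l []       = 1ℚ
chain l (y ∷ ys) = gate l y * chain y ys

Below : ∀ {n} → ℤ → (Fin n → ℤ) → Set
Below l a = ∀ i → l ℤ.< a i

StrictlyIncreasing : ∀ {n} → (Fin n → ℤ) → Set
StrictlyIncreasing a = ∀ i j → i Fin.< j → a i ℤ.< a j

-- The sum of ∏ᵢ fᵢ(yᵢ) over l < y₁ < ⋯ < yₙ with yᵢ ∈ {aᵢ, aᵢ + 1}.
twoPointSum : ∀ {n} → (Fin n → ℤ) → (Fin n → ℤ → ℚ) → ℤ → ℚ
twoPointSum {zero}  a f l = 1ℚ
twoPointSum {suc n} a f l = term (a zero) + term (a zero ℤ.+ + 1)
  where
  term : ℤ → ℚ
  term y = gate l y * (f zero y * twoPointSum (a ∘ suc) (f ∘ suc) y)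

-- The support condition on f restricts each coordinate to its two points and puts those that
-- contribute into ys; hence no term is lost in replacing one range by the other.
∑-chain : ∀ {ys} → Unique ys → ∀ {n} (a : Fin n → ℤ) (f : Fin n → ℤ → ℚ) →
  (∀ i {y} → f i y ≢ 0ℚ → (y ≡ a i ⊎ y ≡ a i ℤ.+ + 1) × y ∈ ys) → ∀ l →
  ∑ (allVecs ys n) (λ y → chain l y * ∏ℚ (λ i → f i (lookup y i))) ≡ twoPointSum a f l
∑-chain u {zero}  a f supp l = refl
∑-chain {ys} u {suc n} a f supp l = begin
  ∑ (allVecs ys (suc n)) (λ y → chain l y * ∏ℚ (λ i → f i (lookup y i)))
    ≡⟨ ∑-cartesianProductWith _∷_ ys (allVecs ys n) (λ y → chain l y * ∏ℚ (λ i → f i (lookup y i))) ⟩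
  ∑ ys (λ y → ∑ (allVecs ys n) λ v → gate l y * chain y v * (f zero y * g v))
    ≡⟨ ∑-cong ys (λ {y} _ → inner y) ⟩
  ∑ ys term
    ≡⟨ ∑-support ℤ._≟_ u ((i≢i+1 ∷ []) ∷ [] ∷ []) term (λ {y} _ → off y) (λ {y} _ → out y) ⟩
  term (a zero) + (term (a zero ℤ.+ + 1) + 0ℚ)
    ≡⟨ cong (term (a zero) ℚ.+_) (ℚ.+-identityʳ _) ⟩
  term (a zero) + term (a zero ℤ.+ + 1) ∎
  where
  open ≡-Reasoning
  g : Vec ℤ n → ℚ
  g v = ∏ℚ (λ i → f (suc i) (lookup v i))

  term : ℤ → ℚ
  term y = gate l y * (f zero y * twoPointSum (a ∘ suc) (f ∘ suc) y)

  inner : ∀ y → ∑ (allVecs ys n) (λ v → gate l y * chain y v * (f zero y * g v)) ≡ term y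
  inner y = begin
    ∑ (allVecs ys n) (λ v → gate l y * chain y v * (f zero y * g v))
      ≡⟨ ∑-cong (allVecs ys n) (λ {v} _ → solve 4 (λ a b c d → a :* b :* (c :* d) := a :* c :* (b :* d)) refl
           (gate l y) (chain y v) (f zero y) (g v)) ⟩
    ∑ (allVecs ys n) (λ v → gate l y * f zero y * (chain y v * g v))
      ≡⟨ ∑-*ˡ (allVecs ys n) (gate l y * f zero y) (λ v → chain y v * g v) ⟩
    gate l y * f zero y * ∑ (allVecs ys n) (λ v → chain y v * g v)
      ≡⟨ cong (gate l y * f zero y *_) (∑-chain u (a ∘ suc) (f ∘ suc) (supp ∘ suc) y) ⟩
    gate l y * f zero y * twoPointSum (a ∘ suc) (f ∘ suc) y
      ≡⟨ ℚ.*-assoc (gate l y) (f zero y) _ ⟩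
    term y ∎

  zero-term : ∀ y → f zero y ≡ 0ℚ → term y ≡ 0ℚ
  zero-term y eq = trans (cong (gate l y *_) (zero* eq (twoPointSum (a ∘ suc) (f ∘ suc) y))) (ℚ.*-zeroʳ (gate l y))

  off : ∀ y → y ∉ a zero ∷ a zero ℤ.+ + 1 ∷ [] → term y ≡ 0ℚ
  off y y∉ with f zero y ℚ.≟ 0ℚ
  ... | yes eq = zero-term y eq
  ... | no ≢0 with proj₁ (supp zero ≢0)
  ...   | inj₁ eq = contradiction (here eq) y∉
  ...   | inj₂ eq = contradiction (there (here eq)) y∉

  out : ∀ y → y ∉ ys → term y ≡ 0ℚ
  out y y∉ with f zero y ℚ.≟ 0ℚ
  ... | yes eq = zero-term y eq
  ... | no ≢0  = contradiction (proj₂ (supp zero ≢0)) y∉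

twoPointSum-first : ∀ {n} (a : Fin (suc n) → ℤ) f {l} → l ℤ.< a zero →
  twoPointSum a f l ≡ f zero (a zero) * twoPointSum (a ∘ suc) (f ∘ suc) (a zero)
                    + f zero (a zero ℤ.+ + 1) * twoPointSum (a ∘ suc) (f ∘ suc) (a zero ℤ.+ + 1)
twoPointSum-first a f l<a = cong₂ _+_
  (one* (gate-< l<a) (f zero (a zero) * F (a zero)))
  (one* (gate-< (ℤ.<-trans l<a i<i+1)) (f zero (a zero ℤ.+ + 1) * F (a zero ℤ.+ + 1)))
  where
  F : ℤ → ℚ
  F = twoPointSum (a ∘ suc) (f ∘ suc)

-- Only the first coordinate is compared with the lower bound, and a bound below its range is inert.
twoPointSum-below : ∀ {n} (a : Fin n → ℤ) f {l m} → Below l a → Below m a →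
                    twoPointSum a f l ≡ twoPointSum a f m
twoPointSum-below {zero}  a f _ _ = refl
twoPointSum-below {suc n} a f l<a m<a =
  trans (twoPointSum-first a f (l<a zero)) (sym (twoPointSum-first a f (m<a zero)))

-- fᵢ(aᵢ + 1) fⱼ(aⱼ) is the weight of the coincidence yᵢ = yⱼ, possible only if aⱼ = aᵢ + 1.
clash : ∀ {n} → (Fin n → ℤ) → (Fin n → ℤ → ℚ) → Fin n → Fin n → ℚ
clash a f i j = if does (a j ℤ.≟ a i ℤ.+ + 1) then f i (a i ℤ.+ + 1) * f j (a j) else 0ℚ

-- Inclusion-exclusion over the coincidence y₁ = y₂; no other constraint involves y₁.
twoPointSum-recurrence : ∀ {n} (a : Fin (suc (suc n)) → ℤ) f {l} → StrictlyIncreasing a → Below l a →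
  twoPointSum a f l ≡
    (f zero (a zero) + f zero (a zero ℤ.+ + 1)) * twoPointSum (a ∘ suc) (f ∘ suc) l
    + - (clash a f zero (suc zero) * twoPointSum (tail (tail a)) (tail (tail f)) l)
twoPointSum-recurrence {n} a f {l} inc l<a = begin
  twoPointSum a f l                ≡⟨ twoPointSum-first a f (l<a zero) ⟩
  p * F (a zero) + q * F (a zero ℤ.+ + 1)
    ≡⟨ cong (λ s → p * s + q * F (a zero ℤ.+ + 1))
         (twoPointSum-below (a ∘ suc) (f ∘ suc) (λ i → inc zero (suc i) (ℕ.s≤s ℕ.z≤n)) (l<a ∘ suc)) ⟩
  p * F l + q * F (a zero ℤ.+ + 1) ≡⟨ second ⟩
  (p + q) * F l + - (clash a f zero (suc zero) * G l) ∎
  where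
  open ≡-Reasoning
  p q : ℚ
  p = f zero (a zero)
  q = f zero (a zero ℤ.+ + 1)
  F G : ℤ → ℚ
  F = twoPointSum (a ∘ suc) (f ∘ suc)
  G = twoPointSum (tail (tail a)) (tail (tail f))
  r s : ℚ
  r = f (suc zero) (a (suc zero))
  s = f (suc zero) (a (suc zero) ℤ.+ + 1)

  a₀<a₁ : a zero ℤ.< a (suc zero)
  a₀<a₁ = inc zero (suc zero) (ℕ.s≤s ℕ.z≤n)

  second : p * F l + q * F (a zero ℤ.+ + 1) ≡ (p + q) * F l + - (clash a f zero (suc zero) * G l)
  second with a (suc zero) ℤ.≟ a zero ℤ.+ + 1
  -- Disjoint ranges: a₀ + 1 still lies below all later points, so both values of the first
  -- coordinate leave the same remaining sum.
  ... | no a₁≢ = begin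
    p * F l + q * F (a zero ℤ.+ + 1) ≡⟨ cong (λ s → p * F l + q * s)
      (twoPointSum-below (a ∘ suc) (f ∘ suc) below (l<a ∘ suc)) ⟩
    p * F l + q * F l               ≡⟨ ℚ.*-distribʳ-+ (F l) p q ⟨
    (p + q) * F l                   ≡⟨ ℚ.+-identityʳ _ ⟨
    (p + q) * F l + 0ℚ              ≡⟨ cong (λ z → (p + q) * F l + - z) (ℚ.*-zeroˡ (G l)) ⟨
    (p + q) * F l + - (0ℚ * G l)    ∎
    where
    a₀+1<a₁ : a zero ℤ.+ + 1 ℤ.< a (suc zero)
    a₀+1<a₁ = ℤ.≤∧≢⇒< (subst (ℤ._≤ a (suc zero)) (ℤ.+-comm (+ 1) (a zero)) (ℤ.i<j⇒suc[i]≤j a₀<a₁)) (a₁≢ ∘ sym)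
    below : Below (a zero ℤ.+ + 1) (a ∘ suc)
    below zero    = a₀+1<a₁
    below (suc i) = ℤ.<-trans a₀+1<a₁ (inc (suc zero) (suc (suc i)) (ℕ.s≤s (ℕ.s≤s ℕ.z≤n)))
  -- The ranges share the point a₁ = a₀ + 1. With y₁ there, y₂ = a₁ is forbidden and only s * H
  -- remains of the sum over the rest; the missing q * r * G a₁ is the clash term.
  ... | yes a₁≡ = begin
    p * F l + q * F (a zero ℤ.+ + 1)
      ≡⟨ cong₂ (λ u v → p * u + q * v) (twoPointSum-first (a ∘ suc) (f ∘ suc) (l<a (suc zero))) F-clash ⟩
    p * (r * G a₁ + s * H) + q * (s * H)
      ≡⟨ solve 6 (λ p q r s g h → p :* (r :* g :+ s :* h) :+ q :* (s :* h)
           := (p :+ q) :* (r :* g :+ s :* h) :+ :- (q :* r :* g)) refl p q r s (G a₁) H ⟩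
    (p + q) * (r * G a₁ + s * H) + - (q * r * G a₁)
      ≡⟨ cong₂ (λ u v → (p + q) * u + - (q * r * v))
           (twoPointSum-first (a ∘ suc) (f ∘ suc) (l<a (suc zero)))
           (twoPointSum-below (tail (tail a)) (tail (tail f)) (λ i → l<a (suc (suc i)))
             (λ i → inc (suc zero) (suc (suc i)) (ℕ.s≤s (ℕ.s≤s ℕ.z≤n)))) ⟨
    (p + q) * F l + - (q * r * G l) ∎
    where
    a₁ : ℤ
    a₁ = a (suc zero)
    H : ℚ
    H = G (a₁ ℤ.+ + 1)
    F-clash : F (a zero ℤ.+ + 1) ≡ s * H
    F-clash = trans (cong₂ _+_
      (zero* (gate-≮ (λ lt → ℤ.<-irrefl (sym a₁≡) lt)) (r * G a₁))
      (one* (gate-< (subst (ℤ._< a₁ ℤ.+ + 1) a₁≡ i<i+1)) (s * H)))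
      (ℚ.+-identityˡ (s * H))

-- The recurrence reads a and f only through one-point totals and clashes of neighbours, so sums
-- over different point sets agree once these data do. One coordinate is a separate base case
-- because the recurrence looks two coordinates ahead.
twoPointSum-≡ : ∀ {n} (a a′ : Fin n → ℤ) f f′ {l m} →
  StrictlyIncreasing a → StrictlyIncreasing a′ → Below l a → Below m a′ →
  (∀ i → f i (a i) + f i (a i ℤ.+ + 1) ≡ f′ i (a′ i) + f′ i (a′ i ℤ.+ + 1)) →
  (∀ i j → i Fin.< j → clash a f i j ≡ clash a′ f′ i j) →
  twoPointSum a f l ≡ twoPointSum a′ f′ m
twoPointSum-≡ {zero} a a′ f f′ inc inc′ l<a m<a′ single double = refl
twoPointSum-≡ {suc zero} a a′ f f′ inc inc′ l<a m<a′ single double =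
  trans (expand a f l<a) (trans (single zero) (sym (expand a′ f′ m<a′)))
  where
  expand : ∀ a f {l} → Below l a → twoPointSum a f l ≡ f zero (a zero) + f zero (a zero ℤ.+ + 1)
  expand a f l<a = trans (twoPointSum-first a f (l<a zero))
    (cong₂ _+_ (ℚ.*-identityʳ (f zero (a zero))) (ℚ.*-identityʳ (f zero (a zero ℤ.+ + 1))))
twoPointSum-≡ {suc (suc n)} a a′ f f′ {l} {m} inc inc′ l<a m<a′ single double = begin
  twoPointSum a f l    ≡⟨ twoPointSum-recurrence a f inc l<a ⟩
  _                    ≡⟨ cong₂ (λ u v → u + - v)
    (cong₂ _*_ (single zero) (twoPointSum-≡ (a ∘ suc) (a′ ∘ suc) (f ∘ suc) (f′ ∘ suc)
      (λ i j i<j → inc (suc i) (suc j) (ℕ.s≤s i<j)) (λ i j i<j → inc′ (suc i) (suc j) (ℕ.s≤s i<j))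
      (l<a ∘ suc) (m<a′ ∘ suc) (single ∘ suc) (λ i j i<j → double (suc i) (suc j) (ℕ.s≤s i<j))))
    (cong₂ _*_ (double zero (suc zero) (ℕ.s≤s ℕ.z≤n))
      (twoPointSum-≡ (tail (tail a)) (tail (tail a′)) (tail (tail f)) (tail (tail f′))
      (λ i j i<j → inc (suc (suc i)) (suc (suc j)) (ℕ.s≤s (ℕ.s≤s i<j)))
      (λ i j i<j → inc′ (suc (suc i)) (suc (suc j)) (ℕ.s≤s (ℕ.s≤s i<j)))
      (λ i → l<a (suc (suc i))) (λ i → m<a′ (suc (suc i))) (λ i → single (suc (suc i)))
      (λ i j i<j → double (suc (suc i)) (suc (suc j)) (ℕ.s≤s (ℕ.s≤s i<j))))) ⟩
  _                    ≡⟨ twoPointSum-recurrence a′ f′ inc′ m<a′ ⟨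
  twoPointSum a′ f′ m  ∎
  where open ≡-Reasoning

-- Window bounds and the supports of the weights

if-dec : ∀ {P A : Set} (P? : Dec P) {a b c : A} → (P → a ≡ c) → (¬ P → b ≡ c) →
         (if does P? then a else b) ≡ c
if-dec (yes p) h _ = h p
if-dec (no ¬p) _ h = h ¬p

-- Max and min are split into four inequalities, written so that the factors of the weights appear:
-- the first expression is the down factor of `w₂`, the second the flat factor of `w₁`, the fourth
-- the up factor of `w₁` and the flat factor of `w₂`.
record Bounds (N T S t : ℕ) (x : ℤ) : Set where
  constructor bounds
  field
    x≥0      : + 0 ℤ.≤ x
    x≥t+S-T  : + 0 ℤ.≤ x ℤ.+ + T ℤ.- + t ℤ.- + S
    x<t+N    : + 0 ℤ.≤ + t ℤ.+ + N ℤ.- + 1 ℤ.- x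
    x<S+N    : + 0 ℤ.≤ + S ℤ.+ + N ℤ.- + 1 ℤ.- x

In𝔛⇒Bounds : ∀ {N T S t x} → In𝔛 N T S t x → Bounds N T S t x
In𝔛⇒Bounds {N} {T} {S} {t} {x} (lo , hi) = bounds
  (ℤ.≤-trans (ℤ.i≤i⊔j (+ 0) (+ t ℤ.+ + S ℤ.- + T)) lo)
  (resp-nonneg (ℤ.i≤j⇒0≤j-i (ℤ.≤-trans (ℤ.i≤j⊔i (+ 0) (+ t ℤ.+ + S ℤ.- + T)) lo)) (lem x (+ T) (+ t) (+ S)))
  (ℤ.i≤j⇒0≤j-i (ℤ.≤-trans hi (ℤ.i⊓j≤i (+ t ℤ.+ + N ℤ.- + 1) (+ S ℤ.+ + N ℤ.- + 1))))
  (ℤ.i≤j⇒0≤j-i (ℤ.≤-trans hi (ℤ.i⊓j≤j (+ t ℤ.+ + N ℤ.- + 1) (+ S ℤ.+ + N ℤ.- + 1))))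
  where
  lem : ∀ x T t S → x ℤ.- (t ℤ.+ S ℤ.- T) ≡ x ℤ.+ T ℤ.- t ℤ.- S
  lem = solve-∀

Bounds⇒In𝔛 : ∀ {N T S t x} → Bounds N T S t x → In𝔛 N T S t x
Bounds⇒In𝔛 {N} {T} {S} {t} {x} (bounds a b c d) =
  ℤ.⊔-lub a (ℤ.0≤i-j⇒j≤i (resp-nonneg b (lem x (+ T) (+ t) (+ S)))) ,
  ℤ.⊓-glb (ℤ.0≤i-j⇒j≤i c) (ℤ.0≤i-j⇒j≤i d)
  where
  lem : ∀ x T t S → x ℤ.+ T ℤ.- t ℤ.- S ≡ x ℤ.- (t ℤ.+ S ℤ.- T)
  lem = solve-∀

nonneg∧≢0⇒pred-nonneg : ∀ {a} → + 0 ℤ.≤ a → a ≢ + 0 → + 0 ℤ.≤ a ℤ.- + 1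
nonneg∧≢0⇒pred-nonneg h ≢0 = pos⇒pred-nonneg (ℤ.≤∧≢⇒< h (≢0 ∘ sym))

-- The weight of a step vanishes exactly when the step would cross a wall: the up factor at x = S +
-- N - 1, the flat factor at x = t + S - T. The other two bounds survive every step. `w₂-bounds`
-- rests on the same effect, with walls at 0 and at the top of the window for S + 1.
w₁-bounds : ∀ N T S t {x y} → Bounds N T S t x → w₁ N T S t x y ≢ + 0 → Bounds N T S (suc t) y
w₁-bounds N T S t {x} {y} (bounds a b c d) ≢0 with y ℤ.≟ x ℤ.+ + 1 | y ℤ.≟ x
... | yes refl | _ = bounds
  (+-nonneg a 0≤1)
  (resp-nonneg b (lem₁ x (+ T) (+ t) (+ S)))
  (resp-nonneg c (lem₂ x (+ t) (+ N)))
  (resp-nonneg (nonneg∧≢0⇒pred-nonneg d (≢0 ∘ trans (lem₃ x (+ N) (+ S)))) (lem₄ x (+ N) (+ S)))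
  where
  lem₁ : ∀ x T t S → x ℤ.+ T ℤ.- t ℤ.- S ≡ x ℤ.+ + 1 ℤ.+ T ℤ.- (+ 1 ℤ.+ t) ℤ.- S
  lem₁ = solve-∀
  lem₂ : ∀ x t N → t ℤ.+ N ℤ.- + 1 ℤ.- x ≡ + 1 ℤ.+ t ℤ.+ N ℤ.- + 1 ℤ.- (x ℤ.+ + 1)
  lem₂ = solve-∀
  lem₃ : ∀ x N S → N ℤ.+ S ℤ.- x ℤ.- + 1 ≡ S ℤ.+ N ℤ.- + 1 ℤ.- x
  lem₃ = solve-∀
  lem₄ : ∀ x N S → S ℤ.+ N ℤ.- + 1 ℤ.- x ℤ.- + 1 ≡ S ℤ.+ N ℤ.- + 1 ℤ.- (x ℤ.+ + 1)
  lem₄ = solve-∀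
... | no _ | yes refl = bounds
  a
  (resp-nonneg (nonneg∧≢0⇒pred-nonneg b ≢0) (lem₁ x (+ T) (+ t) (+ S)))
  (resp-nonneg (+-nonneg c 0≤1) (lem₂ x (+ t) (+ N)))
  d
  where
  lem₁ : ∀ x T t S → x ℤ.+ T ℤ.- t ℤ.- S ℤ.- + 1 ≡ x ℤ.+ T ℤ.- (+ 1 ℤ.+ t) ℤ.- S
  lem₁ = solve-∀
  lem₂ : ∀ x t N → t ℤ.+ N ℤ.- + 1 ℤ.- x ℤ.+ + 1 ≡ + 1 ℤ.+ t ℤ.+ N ℤ.- + 1 ℤ.- x
  lem₂ = solve-∀
... | no _ | no _ = contradiction refl ≢0

w₂-bounds : ∀ N T S t {x y} → Bounds N T (suc S) t x → w₂ N (suc S) x y ≢ + 0 → Bounds N T S t y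
w₂-bounds N T S t {x} {y} (bounds a b c d) ≢0 with y ℤ.≟ x ℤ.- + 1 | y ℤ.≟ x
... | yes refl | _ = bounds
  (nonneg∧≢0⇒pred-nonneg a ≢0)
  (resp-nonneg b (lem₁ x (+ T) (+ t) (+ S)))
  (resp-nonneg (+-nonneg c 0≤1) (lem₂ x (+ t) (+ N)))
  (resp-nonneg d (lem₃ x (+ N) (+ S)))
  where
  lem₁ : ∀ x T t S → x ℤ.+ T ℤ.- t ℤ.- (+ 1 ℤ.+ S) ≡ x ℤ.- + 1 ℤ.+ T ℤ.- t ℤ.- S
  lem₁ = solve-∀
  lem₂ : ∀ x t N → t ℤ.+ N ℤ.- + 1 ℤ.- x ℤ.+ + 1 ≡ t ℤ.+ N ℤ.- + 1 ℤ.- (x ℤ.- + 1)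
  lem₂ = solve-∀
  lem₃ : ∀ x N S → + 1 ℤ.+ S ℤ.+ N ℤ.- + 1 ℤ.- x ≡ S ℤ.+ N ℤ.- + 1 ℤ.- (x ℤ.- + 1)
  lem₃ = solve-∀
... | no _ | yes refl = bounds
  a
  (resp-nonneg (+-nonneg b 0≤1) (lem₁ x (+ T) (+ t) (+ S)))
  c
  (resp-nonneg (nonneg∧≢0⇒pred-nonneg d ≢0) (lem₂ x (+ N) (+ S)))
  where
  lem₁ : ∀ x T t S → x ℤ.+ T ℤ.- t ℤ.- (+ 1 ℤ.+ S) ℤ.+ + 1 ≡ x ℤ.+ T ℤ.- t ℤ.- S
  lem₁ = solve-∀
  lem₂ : ∀ x N S → + 1 ℤ.+ S ℤ.+ N ℤ.- + 1 ℤ.- x ℤ.- + 1 ≡ S ℤ.+ N ℤ.- + 1 ℤ.- x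
  lem₂ = solve-∀
... | no _ | no _ = contradiction refl ≢0

-- Commutation identities for one and two particles

i+1-1≡i : ∀ i → i ℤ.+ + 1 ℤ.- + 1 ≡ i
i+1-1≡i = solve-∀

i-1+1≡i : ∀ i → i ℤ.- + 1 ℤ.+ + 1 ≡ i
i-1+1≡i = solve-∀

w₁-up : ∀ N T S t x → w₁ N T S t x (x ℤ.+ + 1) ≡ + N ℤ.+ + S ℤ.- x ℤ.- + 1
w₁-up N T S t x = two-fst {x ℤ.+ + 1} {x} refl

w₁-flat : ∀ N T S t x → w₁ N T S t x x ≡ x ℤ.+ + T ℤ.- + t ℤ.- + S
w₁-flat N T S t x = two-snd {x ℤ.+ + 1} {x} (i≢i+1 ∘ sym) refl

w₁-off : ∀ N T S t {x y} → y ≢ x ℤ.+ + 1 → y ≢ x → w₁ N T S t x y ≡ + 0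
w₁-off N T S t {x} = two-off {x ℤ.+ + 1} {x}

w₂-down : ∀ N S x → w₂ N S x (x ℤ.- + 1) ≡ x
w₂-down N S x = two-fst {x ℤ.- + 1} {x} refl

w₂-flat : ∀ N S x → w₂ N S x x ≡ + S ℤ.+ + N ℤ.- + 1 ℤ.- x
w₂-flat N S x = two-snd {x ℤ.- + 1} {x} i-1≢i refl

w₂-off : ∀ N S {x y} → y ≢ x ℤ.- + 1 → y ≢ x → w₂ N S x y ≡ + 0
w₂-off N S {x} = two-off {x ℤ.- + 1} {x}

i-1<i : ∀ {i} → i ℤ.- + 1 ℤ.< i
i-1<i {i} = subst (i ℤ.- + 1 ℤ.<_) (i-1+1≡i i) i<i+1

i-1≢i+1 : ∀ {i} → i ℤ.- + 1 ≢ i ℤ.+ + 1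
i-1≢i+1 {i} eq = ℤ.<-irrefl eq (ℤ.<-trans i-1<i (i<i+1 {i}))

-- The two-step totals from x to z agree, by a polynomial identity for each of z = x - 1, x, x + 1.
-- Only z = x has two routes in each order; there both totals are (S + N - x)(2x + T - t - S).
one-particle-commutation : ∀ N T S t x z →
  w₁ N T (suc S) t x x ℤ.* w₂ N (suc S) x z
    ℤ.+ w₁ N T (suc S) t x (x ℤ.+ + 1) ℤ.* w₂ N (suc S) (x ℤ.+ + 1) z
  ≡ w₂ N (suc S) x (x ℤ.- + 1) ℤ.* w₁ N T S t (x ℤ.- + 1) z
    ℤ.+ w₂ N (suc S) x x ℤ.* w₁ N T S t x z
one-particle-commutation N T S t x z = begin
  w₁ N T (suc S) t x x ℤ.* w₂ N (suc S) x z ℤ.+ w₁ N T (suc S) t x (x ℤ.+ + 1) ℤ.* w₂ N (suc S) (x ℤ.+ + 1) z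
    ≡⟨ cong₂ (λ a b → a ℤ.* w₂ N (suc S) x z ℤ.+ b ℤ.* w₂ N (suc S) (x ℤ.+ + 1) z)
         (w₁-flat N T (suc S) t x) (w₁-up N T (suc S) t x) ⟩
  B ℤ.* w₂ N (suc S) x z ℤ.+ A ℤ.* w₂ N (suc S) (x ℤ.+ + 1) z
    ≡⟨ main (z ℤ.≟ x ℤ.- + 1) (z ℤ.≟ x) (z ℤ.≟ x ℤ.+ + 1) ⟩
  x ℤ.* w₁ N T S t (x ℤ.- + 1) z ℤ.+ C ℤ.* w₁ N T S t x z
    ≡⟨ cong₂ (λ a b → a ℤ.* w₁ N T S t (x ℤ.- + 1) z ℤ.+ b ℤ.* w₁ N T S t x z)
         (w₂-down N (suc S) x) (w₂-flat N (suc S) x) ⟨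
  w₂ N (suc S) x (x ℤ.- + 1) ℤ.* w₁ N T S t (x ℤ.- + 1) z ℤ.+ w₂ N (suc S) x x ℤ.* w₁ N T S t x z ∎
  where
  open ≡-Reasoning
  A B C : ℤ
  A = + N ℤ.+ + suc S ℤ.- x ℤ.- + 1
  B = x ℤ.+ + T ℤ.- + t ℤ.- + suc S
  C = + suc S ℤ.+ + N ℤ.- + 1 ℤ.- x

  combine : ∀ {a b c d a′ b′ c′ d′} → a ≡ a′ → b ≡ b′ → c ≡ c′ → d ≡ d′ →
            B ℤ.* a′ ℤ.+ A ℤ.* b′ ≡ x ℤ.* c′ ℤ.+ C ℤ.* d′ → B ℤ.* a ℤ.+ A ℤ.* b ≡ x ℤ.* c ℤ.+ C ℤ.* d
  combine refl refl refl refl eq = eq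

  main : Dec (z ≡ x ℤ.- + 1) → Dec (z ≡ x) → Dec (z ≡ x ℤ.+ + 1) →
         B ℤ.* w₂ N (suc S) x z ℤ.+ A ℤ.* w₂ N (suc S) (x ℤ.+ + 1) z
         ≡ x ℤ.* w₁ N T S t (x ℤ.- + 1) z ℤ.+ C ℤ.* w₁ N T S t x z
  main (yes refl) _ _ = combine
    (w₂-down N (suc S) x)
    (w₂-off N (suc S) (λ eq → i-1≢i (trans eq (i+1-1≡i x))) (i-1≢i+1 {x}))
    (w₁-flat N T S t (x ℤ.- + 1))
    (w₁-off N T S t {x} (i-1≢i+1 {x}) i-1≢i)
    (lem x (+ N) (+ T) (+ S) (+ t))
    where
    lem : ∀ x N T S t → (x ℤ.+ T ℤ.- t ℤ.- (+ 1 ℤ.+ S)) ℤ.* x ℤ.+ (N ℤ.+ (+ 1 ℤ.+ S) ℤ.- x ℤ.- + 1) ℤ.* + 0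
          ≡ x ℤ.* (x ℤ.- + 1 ℤ.+ T ℤ.- t ℤ.- S) ℤ.+ (+ 1 ℤ.+ S ℤ.+ N ℤ.- + 1 ℤ.- x) ℤ.* + 0
    lem = solve-∀
  main (no _) (yes refl) _ = combine
    (w₂-flat N (suc S) x)
    (trans (cong (w₂ N (suc S) (x ℤ.+ + 1)) (sym (i+1-1≡i x))) (w₂-down N (suc S) (x ℤ.+ + 1)))
    (trans (cong (w₁ N T S t (x ℤ.- + 1)) (sym (i-1+1≡i x))) (w₁-up N T S t (x ℤ.- + 1)))
    (w₁-flat N T S t x)
    (lem x (+ N) (+ T) (+ S) (+ t))
    where
    lem : ∀ x N T S t →
          (x ℤ.+ T ℤ.- t ℤ.- (+ 1 ℤ.+ S)) ℤ.* (+ 1 ℤ.+ S ℤ.+ N ℤ.- + 1 ℤ.- x)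
            ℤ.+ (N ℤ.+ (+ 1 ℤ.+ S) ℤ.- x ℤ.- + 1) ℤ.* (x ℤ.+ + 1)
          ≡ x ℤ.* (N ℤ.+ S ℤ.- (x ℤ.- + 1) ℤ.- + 1)
            ℤ.+ (+ 1 ℤ.+ S ℤ.+ N ℤ.- + 1 ℤ.- x) ℤ.* (x ℤ.+ T ℤ.- t ℤ.- S)
    lem = solve-∀
  main (no z≢x-1) (no z≢x) (yes refl) = combine
    (w₂-off N (suc S) z≢x-1 z≢x)
    (w₂-flat N (suc S) (x ℤ.+ + 1))
    (w₁-off N T S t (λ eq → z≢x (trans eq (i-1+1≡i x))) z≢x-1)
    (w₁-up N T S t x)
    (lem x (+ N) (+ T) (+ S) (+ t))
    where
    lem : ∀ x N T S t →
          (x ℤ.+ T ℤ.- t ℤ.- (+ 1 ℤ.+ S)) ℤ.* + 0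
            ℤ.+ (N ℤ.+ (+ 1 ℤ.+ S) ℤ.- x ℤ.- + 1) ℤ.* (+ 1 ℤ.+ S ℤ.+ N ℤ.- + 1 ℤ.- (x ℤ.+ + 1))
          ≡ x ℤ.* + 0 ℤ.+ (+ 1 ℤ.+ S ℤ.+ N ℤ.- + 1 ℤ.- x) ℤ.* (N ℤ.+ S ℤ.- x ℤ.- + 1)
    lem = solve-∀
  main (no z≢x-1) (no z≢x) (no z≢x+1) = combine
    (w₂-off N (suc S) z≢x-1 z≢x)
    (w₂-off N (suc S) (λ eq → z≢x (trans eq (i+1-1≡i x))) z≢x+1)
    (w₁-off N T S t (λ eq → z≢x (trans eq (i-1+1≡i x))) z≢x-1)
    (w₁-off N T S t z≢x+1 z≢x)
    (lem A B C x)
    where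
    lem : ∀ A B C x → B ℤ.* + 0 ℤ.+ A ℤ.* + 0 ≡ x ℤ.* + 0 ℤ.+ C ℤ.* + 0
    lem = solve-∀

-- The coincidences excluded from the two intermediate configurations have the same weight.
clash-commutation : ∀ N T S t x z z′ → z ℤ.< z′ →
  w₁ N T (suc S) t x (x ℤ.+ + 1) ℤ.* w₂ N (suc S) (x ℤ.+ + 1) z
    ℤ.* (w₁ N T (suc S) t (x ℤ.+ + 1) (x ℤ.+ + 1) ℤ.* w₂ N (suc S) (x ℤ.+ + 1) z′)
  ≡ w₂ N (suc S) x x ℤ.* w₁ N T S t x z
    ℤ.* (w₂ N (suc S) (x ℤ.+ + 1) x ℤ.* w₁ N T S t x z′)
clash-commutation N T S t x z z′ z<z′ = combine
  (w₁-up N T (suc S) t x) (w₁-flat N T (suc S) t (x ℤ.+ + 1)) (w₂-flat N (suc S) x)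
  (trans (cong (w₂ N (suc S) (x ℤ.+ + 1)) (sym (i+1-1≡i x))) (w₂-down N (suc S) (x ℤ.+ + 1)))
  (main (z ℤ.≟ x) (z ℤ.≟ x ℤ.+ + 1) (z′ ℤ.≟ x ℤ.+ + 1))
  where
  A B C : ℤ
  A = + N ℤ.+ + suc S ℤ.- x ℤ.- + 1
  B = x ℤ.+ + 1 ℤ.+ + T ℤ.- + t ℤ.- + suc S
  C = + suc S ℤ.+ + N ℤ.- + 1 ℤ.- x

  combine : ∀ {a b c d a′ b′ c′ d′ e f g h} → a ≡ a′ → b ≡ b′ → c ≡ c′ → d ≡ d′ →
            a′ ℤ.* e ℤ.* (b′ ℤ.* f) ≡ c′ ℤ.* g ℤ.* (d′ ℤ.* h) →
            a ℤ.* e ℤ.* (b ℤ.* f) ≡ c ℤ.* g ℤ.* (d ℤ.* h)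
  combine refl refl refl refl eq = eq

  combine′ : ∀ {e f g h e′ f′ g′ h′} → e ≡ e′ → f ≡ f′ → g ≡ g′ → h ≡ h′ →
            A ℤ.* e′ ℤ.* (B ℤ.* f′) ≡ C ℤ.* g′ ℤ.* ((x ℤ.+ + 1) ℤ.* h′) →
            A ℤ.* e ℤ.* (B ℤ.* f) ≡ C ℤ.* g ℤ.* ((x ℤ.+ + 1) ℤ.* h)
  combine′ refl refl refl refl eq = eq

  left-vanishes : z ≢ x → z ≢ x ℤ.+ + 1 →
    A ℤ.* w₂ N (suc S) (x ℤ.+ + 1) z ℤ.* (B ℤ.* w₂ N (suc S) (x ℤ.+ + 1) z′)
    ≡ C ℤ.* w₁ N T S t x z ℤ.* ((x ℤ.+ + 1) ℤ.* w₁ N T S t x z′)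
  left-vanishes z≢x z≢x+1 = combine′
    (w₂-off N (suc S) (λ eq → z≢x (trans eq (i+1-1≡i x))) z≢x+1) refl
    (w₁-off N T S t z≢x+1 z≢x) refl
    (lem A B C x (w₂ N (suc S) (x ℤ.+ + 1) z′) (w₁ N T S t x z′))
    where
    lem : ∀ A B C x f h → A ℤ.* + 0 ℤ.* (B ℤ.* f) ≡ C ℤ.* + 0 ℤ.* ((x ℤ.+ + 1) ℤ.* h)
    lem = solve-∀

  right-vanishes : z′ ≢ x → z′ ≢ x ℤ.+ + 1 →
    A ℤ.* w₂ N (suc S) (x ℤ.+ + 1) z ℤ.* (B ℤ.* w₂ N (suc S) (x ℤ.+ + 1) z′)
    ≡ C ℤ.* w₁ N T S t x z ℤ.* ((x ℤ.+ + 1) ℤ.* w₁ N T S t x z′)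
  right-vanishes z′≢x z′≢x+1 = combine′
    refl (w₂-off N (suc S) (λ eq → z′≢x (trans eq (i+1-1≡i x))) z′≢x+1)
    refl (w₁-off N T S t z′≢x+1 z′≢x)
    (lem A B C x (w₂ N (suc S) (x ℤ.+ + 1) z) (w₁ N T S t x z))
    where
    lem : ∀ A B C x e g → A ℤ.* e ℤ.* (B ℤ.* + 0) ≡ C ℤ.* g ℤ.* ((x ℤ.+ + 1) ℤ.* + 0)
    lem = solve-∀

  main : Dec (z ≡ x) → Dec (z ≡ x ℤ.+ + 1) → Dec (z′ ≡ x ℤ.+ + 1) →
         A ℤ.* w₂ N (suc S) (x ℤ.+ + 1) z ℤ.* (B ℤ.* w₂ N (suc S) (x ℤ.+ + 1) z′)
         ≡ C ℤ.* w₁ N T S t x z ℤ.* ((x ℤ.+ + 1) ℤ.* w₁ N T S t x z′)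
  -- Each side vanishes unless z and z′ both lie in {x, x + 1}, so z < z′ leaves this as the only
  -- nontrivial case.
  main (yes refl) _ (yes refl) = combine′
    (trans (cong (w₂ N (suc S) (x ℤ.+ + 1)) (sym (i+1-1≡i x))) (w₂-down N (suc S) (x ℤ.+ + 1)))
    (w₂-flat N (suc S) (x ℤ.+ + 1)) (w₁-flat N T S t x) (w₁-up N T S t x)
    (lem x (+ N) (+ T) (+ S) (+ t))
    where
    lem : ∀ x N T S t →
      (N ℤ.+ (+ 1 ℤ.+ S) ℤ.- x ℤ.- + 1) ℤ.* (x ℤ.+ + 1)
        ℤ.* ((x ℤ.+ + 1 ℤ.+ T ℤ.- t ℤ.- (+ 1 ℤ.+ S)) ℤ.* (+ 1 ℤ.+ S ℤ.+ N ℤ.- + 1 ℤ.- (x ℤ.+ + 1)))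
      ≡ (+ 1 ℤ.+ S ℤ.+ N ℤ.- + 1 ℤ.- x) ℤ.* (x ℤ.+ T ℤ.- t ℤ.- S)
        ℤ.* ((x ℤ.+ + 1) ℤ.* (N ℤ.+ S ℤ.- x ℤ.- + 1))
    lem = solve-∀
  main (yes refl) _ (no z′≢x+1) = right-vanishes (λ eq → ℤ.<-irrefl (sym eq) z<z′) z′≢x+1
  main (no z≢x) (no z≢x+1) _ = left-vanishes z≢x z≢x+1
  main (no _) (yes refl) _ =
    right-vanishes (λ eq → ℤ.<-irrefl (sym eq) (ℤ.<-trans i<i+1 z<z′)) (λ eq → ℤ.<-irrefl (sym eq) z<z′)

-- Commutation of P-t+ and P-S-

if-pos : ∀ {P : Set} (P? : Dec P) {a b} → (P → + 0 ℤ.< a) → + 0 ℤ.< b → + 0 ℤ.< (if does P? then a else b)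
if-pos (yes p) h _ = h p
if-pos (no _)  _ h = h

Δ-pos : ∀ {N} (x : Config N) → Increasing x → + 0 ℤ.< Δ x
Δ-pos x inc = ∏ℤ-pos λ i → ∏ℤ-pos λ j →
  if-pos (i Fin.<? j) (λ i<j → pred-nonneg⇒pos (<⇒0≤-pred (inc i j i<j))) (ℤ.+<+ (ℕ.s≤s ℕ.z≤n))

poch-pos : ∀ {a} k → + 0 ℤ.< a → + 0 ℤ.< poch a k
poch-pos k 0<a = ∏ℤ-pos {k} λ i → ℤ.+-mono-<-≤ 0<a (ℤ.+≤+ ℕ.z≤n)

Δ≢0 : ∀ {N} (x : Config N) → Increasing x → fromℤ (Δ x) ≢ 0ℚ
Δ≢0 x inc = >⇒≢0 (fromℤ-pos (Δ-pos x inc))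

T-t>0 : ∀ {t T} → t ℕ.< T → + 0 ℤ.< + T ℤ.- + t
T-t>0 {t} {T} t<T = 0≤-pred⇒< (resp-nonneg (<⇒0≤-pred (ℤ.+<+ t<T)) (lem (+ T) (+ t)))
  where
  lem : ∀ T t → T ℤ.- t ℤ.- + 1 ≡ T ℤ.- t ℤ.- + 0 ℤ.- + 1
  lem = solve-∀

pochₜ-pos : ∀ N T {t} → t ℕ.< T → 0ℚ ℚ.< fromℤ (poch (+ T ℤ.- + t) N)
pochₜ-pos N T t<T = fromℤ-pos (poch-pos N (T-t>0 t<T))

pochₛ-pos : ∀ N S → 0ℚ ℚ.< fromℤ (poch (+ suc S) N)
pochₛ-pos N S = fromℤ-pos (poch-pos N (ℤ.+<+ (ℕ.s≤s ℕ.z≤n)))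

P-t+-factored : ∀ N T S t → t ℕ.< T → ∀ X Y → Increasing X →
  P-t+ N T S t X Y ≡ fromℤ (Δ Y) * fromℤ (W₁ N T S t X Y) * (inv (fromℤ (poch (+ T ℤ.- + t) N)) * inv (fromℤ (Δ X)))
P-t+-factored N T S t t<T X Y inc = trans (P-t+-W₁ N T S t X Y) (cong (fromℤ (Δ Y) * fromℤ (W₁ N T S t X Y) *_)
  (trans (cong inv (fromℤ-* (poch (+ T ℤ.- + t) N) (Δ X))) (inv-* (>⇒≢0 (pochₜ-pos N T t<T)) (Δ≢0 X inc))))

P-S--factored : ∀ N T S t X Y → Increasing X →
  P-S- N T (suc S) t X Y ≡ fromℤ (Δ Y) * fromℤ (W₂ N (suc S) X Y) * (inv (fromℤ (poch (+ suc S) N)) * inv (fromℤ (Δ X)))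
P-S--factored N T S t X Y inc = trans (P-S--W₂ N T (suc S) t X Y) (cong (fromℤ (Δ Y) * fromℤ (W₂ N (suc S) X Y) *_)
  (trans (cong inv (fromℤ-* (poch (+ suc S) N) (Δ X))) (inv-* (>⇒≢0 (pochₛ-pos N S)) (Δ≢0 X inc))))

chain-1 : ∀ {n l} (y : Vec ℤ n) → Below l (lookup y) → Increasing y → chain l y ≡ 1ℚ
chain-1 []       l<y inc = refl
chain-1 (y ∷ ys) l<y inc = trans (one* (gate-< (l<y zero)) (chain y ys))
  (chain-1 ys (λ i → inc zero (suc i) (ℕ.s≤s ℕ.z≤n)) (λ i j i<j → inc (suc i) (suc j) (ℕ.s≤s i<j)))

chain-≢0 : ∀ {n l} (y : Vec ℤ n) → chain l y ≢ 0ℚ → Below l (lookup y) × Increasing y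
chain-≢0 []       ≢0 = (λ ()) , (λ ())
chain-≢0 {l = l} (y ∷ ys) ≢0 with l ℤ.<? y
... | no _    = contradiction (ℚ.*-zeroˡ (chain y ys)) ≢0
... | yes l<y with chain-≢0 {l = y} ys (λ eq → ≢0 (trans (ℚ.*-identityˡ (chain y ys)) eq))
...   | y<ys , inc = below , increasing
  where
  below : Below l (lookup (y ∷ ys))
  below zero    = l<y
  below (suc i) = ℤ.<-trans l<y (y<ys i)
  increasing : Increasing (y ∷ ys)
  increasing zero    (suc j) _            = y<ys j
  increasing (suc i) (suc j) (ℕ.s≤s i<j) = inc i j i<j

-- Membership in 𝒳 has two halves: the bounds hold wherever the weights are nonzero, and
-- monotonicity is what `chain` tests. A negative l opens the first gate for every coordinate of the
-- window.
∑-𝒳 : ∀ N T S t (a : Fin N → ℤ) (f : Fin N → ℤ → ℚ) →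
  (∀ i {y} → f i y ≢ 0ℚ → (y ≡ a i ⊎ y ≡ a i ℤ.+ + 1) × Bounds N T S t y) → ∀ {l} → l ℤ.< + 0 →
  ∑ (𝒳 N T S t) (λ y → ∏ℚ (λ i → f i (lookup y i))) ≡ twoPointSum a f l
∑-𝒳 N T S t a f supp {l} l<0 = begin
  ∑ (𝒳 N T S t) F
    ≡⟨ ∑-filter (in𝒳? N T S t) (allVecs (window N S) N) F ⟩
  ∑ (allVecs (window N S) N) (λ y → if does (in𝒳? N T S t y) then F y else 0ℚ)
    ≡⟨ ∑-cong (allVecs (window N S) N) (λ {y} _ → if-dec (in𝒳? N T S t y) (inside y) (outside y)) ⟩
  ∑ (allVecs (window N S) N) (λ y → chain l y * F y)
    ≡⟨ ∑-chain (window-unique N S) a f (λ i ≢0 → proj₁ (supp i ≢0) , in-window (proj₂ (supp i ≢0))) l ⟩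
  twoPointSum a f l ∎
  where
  open ≡-Reasoning
  F : Config N → ℚ
  F y = ∏ℚ (λ i → f i (lookup y i))

  in-window : ∀ {y} → Bounds N T S t y → y ∈ window N S
  in-window {y} (bounds y≥0 _ _ y<S+N) =
    ∈-window N S y≥0 (0≤-pred⇒< (resp-nonneg y<S+N (lem y (+ S) (+ N))))
    where
    lem : ∀ y S N → S ℤ.+ N ℤ.- + 1 ℤ.- y ≡ S ℤ.+ N ℤ.- y ℤ.- + 1
    lem = solve-∀

  inside : ∀ y → In𝒳 N T S t y → F y ≡ chain l y * F y
  inside y (y∈ , inc) = sym (one* (chain-1 y
    (λ i → ℤ.<-≤-trans l<0 (Bounds.x≥0 (In𝔛⇒Bounds {N} {T} {S} {t} (y∈ i)))) inc) (F y))

  outside : ∀ y → ¬ In𝒳 N T S t y → 0ℚ ≡ chain l y * F y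
  outside y y∉ with chain l y ℚ.≟ 0ℚ | F y ℚ.≟ 0ℚ
  ... | yes eq | _      = sym (zero* eq (F y))
  ... | no _   | yes eq = sym (trans (cong (chain l y *_) eq) (ℚ.*-zeroʳ (chain l y)))
  ... | no ≢0  | no F≢0 = contradiction
    ((λ i → Bounds⇒In𝔛 (proj₂ (supp i (λ eq → F≢0 (∏ℚ-0 i eq))))) , proj₂ (chain-≢0 {l = l} y ≢0)) y∉

compose-factored : ∀ dx {dy} dz A B p q → dy ≢ 0ℚ →
  dy * A * (p * dx) * (dz * B * (q * inv dy)) ≡ dz * (p * q * dx) * (A * B)
compose-factored dx {dy} dz A B p q dy≢0 = trans
  (solve 8 (λ dx dy iy dz A B p q → dy :* A :* (p :* dx) :* (dz :* B :* (q :* iy))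
    := (dy :* iy) :* (dz :* (p :* q :* dx) :* (A :* B))) refl dx dy (inv dy) dz A B p q)
  (one* (*-inv dy≢0) _)

fromℤ-∏-* : ∀ {n} (f g : Fin n → ℤ) → fromℤ (∏ℤ f) * fromℤ (∏ℤ g) ≡ ∏ℚ (λ i → fromℤ (f i ℤ.* g i))
fromℤ-∏-* f g = trans (sym (fromℤ-* (∏ℤ f) (∏ℤ g)))
  (trans (cong fromℤ (sym (ℤ∏.∑-distrib-+ f g))) (fromℤ-∏ (λ i → f i ℤ.* g i)))

fromℤ-*-≢0 : ∀ m n → fromℤ (m ℤ.* n) ≢ 0ℚ → m ≢ + 0
fromℤ-*-≢0 m n ≢0 refl = ≢0 (cong fromℤ (ℤ.*-zeroˡ n))

-- Membership of x keeps all intermediate points of nonzero weight inside their windows, so both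
-- sums become two-point sums, based at xᵢ and at xᵢ - 1. Monotonicity of z enters through
-- `clash-commutation`.
commutation : ∀ N T S t → t ℕ.< T → ∀ x z → In𝒳 N T (suc S) t x → Increasing z →
  (P-t+ N T (suc S) t ⟨ 𝒳 N T (suc S) (suc t) ⟩ P-S- N T (suc S) (suc t)) x z ≡
  (P-S- N T (suc S) t ⟨ 𝒳 N T S t ⟩ P-t+ N T S t) x z
commutation N T S t t<T x z (x∈ , inc) z-inc = begin
  ∑ 𝒳₁ (λ y → P-t+ N T (suc S) t x y * P-S- N T (suc S) (suc t) y z)
    ≡⟨ ∑-cong 𝒳₁ (λ {y} y∈ → term₁ y (proj₂ (∈𝒳⁻ N T (suc S) (suc t) y∈))) ⟩
  ∑ 𝒳₁ (λ y → dz * (p * q * dx) * ∏ℚ (λ i → f i (lookup y i)))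
    ≡⟨ ∑-*ˡ 𝒳₁ (dz * (p * q * dx)) (λ y → ∏ℚ (λ i → f i (lookup y i))) ⟩
  dz * (p * q * dx) * ∑ 𝒳₁ (λ y → ∏ℚ (λ i → f i (lookup y i)))
    ≡⟨ cong₂ (λ c s → dz * (c * dx) * s) (ℚ.*-comm p q) sums ⟩
  dz * (q * p * dx) * ∑ 𝒳₂ (λ y → ∏ℚ (λ i → f′ i (lookup y i)))
    ≡⟨ ∑-*ˡ 𝒳₂ (dz * (q * p * dx)) (λ y → ∏ℚ (λ i → f′ i (lookup y i))) ⟨
  ∑ 𝒳₂ (λ y → dz * (q * p * dx) * ∏ℚ (λ i → f′ i (lookup y i)))
    ≡⟨ ∑-cong 𝒳₂ (λ {y} y∈ → term₂ y (proj₂ (∈𝒳⁻ N T S t y∈))) ⟨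
  ∑ 𝒳₂ (λ y → P-S- N T (suc S) t x y * P-t+ N T S t y z) ∎
  where
  open ≡-Reasoning
  𝒳₁ 𝒳₂ : List (Config N)
  𝒳₁ = 𝒳 N T (suc S) (suc t)
  𝒳₂ = 𝒳 N T S t

  dx dz p q : ℚ
  dx = inv (fromℤ (Δ x))
  dz = fromℤ (Δ z)
  p = inv (fromℤ (poch (+ T ℤ.- + t) N))
  q = inv (fromℤ (poch (+ suc S) N))

  a a′ : Fin N → ℤ
  a  = lookup x
  a′ i = lookup x i ℤ.- + 1

  g g′ : Fin N → ℤ → ℤ
  g  i y = w₁ N T (suc S) t (lookup x i) y ℤ.* w₂ N (suc S) y (lookup z i)
  g′ i y = w₂ N (suc S) (lookup x i) y ℤ.* w₁ N T S t y (lookup z i)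

  f f′ : Fin N → ℤ → ℚ
  f  i y = fromℤ (g i y)
  f′ i y = fromℤ (g′ i y)

  x-bounds : ∀ i → Bounds N T (suc S) t (lookup x i)
  x-bounds i = In𝔛⇒Bounds (x∈ i)

  term₁ : ∀ y → Increasing y → P-t+ N T (suc S) t x y * P-S- N T (suc S) (suc t) y z
                               ≡ dz * (p * q * dx) * ∏ℚ (λ i → f i (lookup y i))
  term₁ y y-inc = trans
    (cong₂ _*_ (P-t+-factored N T (suc S) t t<T x y inc) (P-S--factored N T S (suc t) y z y-inc))
    (trans (compose-factored dx dz (fromℤ (W₁ N T (suc S) t x y)) (fromℤ (W₂ N (suc S) y z)) p q (Δ≢0 y y-inc))
      (cong (dz * (p * q * dx) *_)
        (fromℤ-∏-* (λ i → w₁ N T (suc S) t (lookup x i) (lookup y i)) (λ i → w₂ N (suc S) (lookup y i) (lookup z i)))))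

  term₂ : ∀ y → Increasing y → P-S- N T (suc S) t x y * P-t+ N T S t y z
                               ≡ dz * (q * p * dx) * ∏ℚ (λ i → f′ i (lookup y i))
  term₂ y y-inc = trans
    (cong₂ _*_ (P-S--factored N T S t x y inc) (P-t+-factored N T S t t<T y z y-inc))
    (trans (compose-factored dx dz (fromℤ (W₂ N (suc S) x y)) (fromℤ (W₁ N T S t y z)) q p (Δ≢0 y y-inc))
      (cong (dz * (q * p * dx) *_)
        (fromℤ-∏-* (λ i → w₂ N (suc S) (lookup x i) (lookup y i)) (λ i → w₁ N T S t (lookup y i) (lookup z i)))))

  f-supp : ∀ i {y} → f i y ≢ 0ℚ → (y ≡ a i ⊎ y ≡ a i ℤ.+ + 1) × Bounds N T (suc S) (suc t) y
  f-supp i {y} ≢0 = swap (two-supp {y = y} w≢0) , w₁-bounds N T (suc S) t (x-bounds i) w≢0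
    where
    w≢0 : w₁ N T (suc S) t (lookup x i) y ≢ + 0
    w≢0 = fromℤ-*-≢0 (w₁ N T (suc S) t (lookup x i) y) (w₂ N (suc S) y (lookup z i)) ≢0

  f′-supp : ∀ i {y} → f′ i y ≢ 0ℚ → (y ≡ a′ i ⊎ y ≡ a′ i ℤ.+ + 1) × Bounds N T S t y
  f′-supp i {y} ≢0 =
    map₂ (λ y≡x → trans y≡x (sym (i-1+1≡i (lookup x i)))) (two-supp {y = y} w≢0) , w₂-bounds N T S t (x-bounds i) w≢0
    where
    w≢0 : w₂ N (suc S) (lookup x i) y ≢ + 0
    w≢0 = fromℤ-*-≢0 (w₂ N (suc S) (lookup x i) y) (w₁ N T S t y (lookup z i)) ≢0

  single : ∀ i → f i (a i) + f i (a i ℤ.+ + 1) ≡ f′ i (a′ i) + f′ i (a′ i ℤ.+ + 1)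
  single i = trans (sym (fromℤ-+ (g i (a i)) (g i (a i ℤ.+ + 1)))) (trans
    (cong fromℤ (one-particle-commutation N T S t (lookup x i) (lookup z i)))
    (trans (fromℤ-+ (g′ i (a′ i)) (g′ i (lookup x i))) (cong (λ u → f′ i (a′ i) + f′ i u) (sym (i-1+1≡i (lookup x i))))))

  double : ∀ i j → i Fin.< j → clash a f i j ≡ clash a′ f′ i j
  double i j i<j with lookup x j ℤ.≟ lookup x i ℤ.+ + 1 | lookup x j ℤ.- + 1 ℤ.≟ lookup x i ℤ.- + 1 ℤ.+ + 1
  ... | no _  | no _   = refl
  ... | no ≢  | yes eq = contradiction
    (trans (sym (i-1+1≡i (lookup x j))) (cong (ℤ._+ + 1) (trans eq (i-1+1≡i (lookup x i))))) ≢
  ... | yes eq | no ≢  = contradiction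
    (trans (cong (ℤ._- + 1) eq) (trans (i+1-1≡i (lookup x i)) (sym (i-1+1≡i (lookup x i))))) ≢
  ... | yes eq | yes eq′ = begin
    f i (a i ℤ.+ + 1) * f j (a j)                ≡⟨ fromℤ-* (g i (a i ℤ.+ + 1)) (g j (a j)) ⟨
    fromℤ (u (lookup x j))                       ≡⟨ cong (fromℤ ∘ u) eq ⟩
    fromℤ (u (lookup x i ℤ.+ + 1))
      ≡⟨ cong fromℤ (clash-commutation N T S t (lookup x i) (lookup z i) (lookup z j) (z-inc i j i<j)) ⟩
    fromℤ (v (lookup x i ℤ.+ + 1) (lookup x i) (lookup x i))
      ≡⟨ cong fromℤ (trans (cong (λ b → v b (lookup x i) (lookup x i)) (sym eq))
           (cong₂ (v (lookup x j)) (sym (i-1+1≡i (lookup x i))) (sym (trans eq′ (i-1+1≡i (lookup x i)))))) ⟩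
    fromℤ (v (lookup x j) (a′ i ℤ.+ + 1) (a′ j)) ≡⟨ fromℤ-* (g′ i (a′ i ℤ.+ + 1)) (g′ j (a′ j)) ⟩
    f′ i (a′ i ℤ.+ + 1) * f′ j (a′ j)            ∎
    where
    -- The positions are abstracted so that xⱼ can be replaced by xᵢ + 1 in all its occurrences at
    -- once.
    u : ℤ → ℤ
    u b = w₁ N T (suc S) t (lookup x i) (lookup x i ℤ.+ + 1) ℤ.* w₂ N (suc S) (lookup x i ℤ.+ + 1) (lookup z i)
          ℤ.* (w₁ N T (suc S) t b b ℤ.* w₂ N (suc S) b (lookup z j))
    v : ℤ → ℤ → ℤ → ℤ
    v b c d = w₂ N (suc S) (lookup x i) c ℤ.* w₁ N T S t c (lookup z i)
          ℤ.* (w₂ N (suc S) b d ℤ.* w₁ N T S t d (lookup z j))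

  below : Below (ℤ.- + 1) a
  below i = ℤ.<-≤-trans ℤ.-<+ (Bounds.x≥0 (x-bounds i))

  -- The base points xᵢ - 1 may equal -1, so the lower bound drops to -2.
  below′ : Below (ℤ.- + 2) a′
  below′ i = 0≤-pred⇒< (resp-nonneg (Bounds.x≥0 (x-bounds i)) (lem (lookup x i)))
    where
    lem : ∀ x → x ≡ x ℤ.- + 1 ℤ.- (ℤ.- + 2) ℤ.- + 1
    lem = solve-∀

  sums : ∑ 𝒳₁ (λ y → ∏ℚ (λ i → f i (lookup y i))) ≡ ∑ 𝒳₂ (λ y → ∏ℚ (λ i → f′ i (lookup y i)))
  sums = trans (∑-𝒳 N T (suc S) (suc t) a f f-supp ℤ.-<+) (trans
    (twoPointSum-≡ a a′ f f′ inc (λ i j i<j → ℤ.+-monoˡ-< (ℤ.- + 1) (inc i j i<j)) below below′ single double)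
    (sym (∑-𝒳 N T S t a′ f′ f′-supp ℤ.-<+)))

-- Positivity

∏ℤ-nonneg : ∀ {n} {f : Fin n → ℤ} → (∀ i → + 0 ℤ.≤ f i) → + 0 ℤ.≤ ∏ℤ f
∏ℤ-nonneg {zero}  _ = 0≤1
∏ℤ-nonneg {suc n} {f} h = subst (ℤ._≤ f zero ℤ.* ∏ℤ (f ∘ suc)) (ℤ.*-zeroʳ (f zero))
  (ℤ.*-monoˡ-≤-nonNeg (f zero) {{ℤ.nonNegative (h zero)}} (∏ℤ-nonneg (h ∘ suc)))

fromℤ-nonneg : ∀ {n} → + 0 ℤ.≤ n → 0ℚ ℚ.≤ fromℤ n
fromℤ-nonneg {n} 0≤n with n ℤ.≟ + 0
... | yes refl = ℚ.≤-refl
... | no n≢0   = ℚ.<⇒≤ (fromℤ-pos (ℤ.≤∧≢⇒< 0≤n (n≢0 ∘ sym)))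

-- A bound at the target y states that the factor minus 1 is nonnegative, which is strict positivity
-- of the factor. This is the counterpart of `w₁-bounds`.
w₁-step : ∀ N T S t {x y} → Bounds N T S (suc t) y → y ≡ x ℤ.+ + 1 ⊎ y ≡ x → + 0 ℤ.< w₁ N T S t x y
w₁-step N T S t {x} (bounds _ _ _ d) (inj₁ refl) =
  subst (+ 0 ℤ.<_) (sym (w₁-up N T S t x)) (pred-nonneg⇒pos (resp-nonneg d (lem x (+ N) (+ S))))
  where
  lem : ∀ x N S → S ℤ.+ N ℤ.- + 1 ℤ.- (x ℤ.+ + 1) ≡ N ℤ.+ S ℤ.- x ℤ.- + 1 ℤ.- + 1
  lem = solve-∀
w₁-step N T S t {x} (bounds _ b _ _) (inj₂ refl) =
  subst (+ 0 ℤ.<_) (sym (w₁-flat N T S t x)) (pred-nonneg⇒pos (resp-nonneg b (lem x (+ T) (+ t) (+ S))))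
  where
  lem : ∀ x T t S → x ℤ.+ T ℤ.- (+ 1 ℤ.+ t) ℤ.- S ≡ x ℤ.+ T ℤ.- t ℤ.- S ℤ.- + 1
  lem = solve-∀

w₂-step : ∀ N T S t {x y} → Bounds N T S t y → y ≡ x ℤ.- + 1 ⊎ y ≡ x → + 0 ℤ.< w₂ N (suc S) x y
w₂-step N T S t {x} (bounds a _ _ _) (inj₁ refl) =
  subst (+ 0 ℤ.<_) (sym (w₂-down N (suc S) x)) (pred-nonneg⇒pos a)
w₂-step N T S t {x} (bounds _ _ _ d) (inj₂ refl) =
  subst (+ 0 ℤ.<_) (sym (w₂-flat N (suc S) x)) (pred-nonneg⇒pos (resp-nonneg d (lem x (+ N) (+ S))))
  where
  lem : ∀ x N S → S ℤ.+ N ℤ.- + 1 ℤ.- x ≡ + 1 ℤ.+ S ℤ.+ N ℤ.- + 1 ℤ.- x ℤ.- + 1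
  lem = solve-∀

pos-or-zero⇒nonneg : ∀ {a} → (a ≢ + 0 → + 0 ℤ.< a) → + 0 ℤ.≤ a
pos-or-zero⇒nonneg {a} h with a ℤ.≟ + 0
... | yes refl = ℤ.≤-refl
... | no a≢0   = ℤ.<⇒≤ (h a≢0)

w₁-nonneg : ∀ N T S t {x y} → Bounds N T S (suc t) y → + 0 ℤ.≤ w₁ N T S t x y
w₁-nonneg N T S t {x} {y} b =
  pos-or-zero⇒nonneg λ ≢0 → w₁-step N T S t b (two-supp {x ℤ.+ + 1} {x} {y = y} ≢0)

w₂-nonneg : ∀ N T S t {x y} → Bounds N T S t y → + 0 ℤ.≤ w₂ N (suc S) x y
w₂-nonneg N T S t {x} {y} b =
  pos-or-zero⇒nonneg λ ≢0 → w₂-step N T S t b (two-supp {x ℤ.- + 1} {x} {y = y} ≢0)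

Step : ∀ {N} → Config N → Config N → Set
Step x y = ∀ i → lookup y i ≡ lookup x i ℤ.+ + 1 ⊎ lookup y i ≡ lookup x i

P-t+-nonneg : ∀ N T S t → t ℕ.< T → ∀ x y → In𝒳 N T S t x → In𝒳 N T S (suc t) y → 0ℚ ℚ.≤ P-t+ N T S t x y
P-t+-nonneg N T S t t<T x y (_ , x-inc) (y∈ , y-inc) = subst (0ℚ ℚ.≤_) (sym (P-t+-factored N T S t t<T x y x-inc))
  (*-nonneg (*-nonneg (ℚ.<⇒≤ (fromℤ-pos (Δ-pos y y-inc)))
                      (fromℤ-nonneg (∏ℤ-nonneg λ i → w₁-nonneg N T S t (In𝔛⇒Bounds (y∈ i)))))
            (ℚ.<⇒≤ (*-pos (inv-pos (pochₜ-pos N T t<T)) (inv-pos (fromℤ-pos (Δ-pos x x-inc))))))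

P-t+-pos : ∀ N T S t → t ℕ.< T → ∀ x y → In𝒳 N T S t x → In𝒳 N T S (suc t) y → Step x y → 0ℚ ℚ.< P-t+ N T S t x y
P-t+-pos N T S t t<T x y (_ , x-inc) (y∈ , y-inc) step = subst (0ℚ ℚ.<_) (sym (P-t+-factored N T S t t<T x y x-inc))
  (*-pos (*-pos (fromℤ-pos (Δ-pos y y-inc))
                (fromℤ-pos (∏ℤ-pos λ i → w₁-step N T S t (In𝔛⇒Bounds (y∈ i)) (step i))))
         (*-pos (inv-pos (pochₜ-pos N T t<T)) (inv-pos (fromℤ-pos (Δ-pos x x-inc)))))

P-t+-≢0⇒Step : ∀ N T S t x y → P-t+ N T S t x y ≢ 0ℚ → Step x y
P-t+-≢0⇒Step N T S t x y ≢0 i = two-supp {y = lookup y i} λ w≡0 → ≢0 (begin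
  P-t+ N T S t x y             ≡⟨ P-t+-W₁ N T S t x y ⟩
  fromℤ (Δ y) * fromℤ (W₁ N T S t x y) * d
    ≡⟨ cong (λ w → fromℤ (Δ y) * fromℤ w * d) (∏ℤ-0 i w≡0) ⟩
  fromℤ (Δ y) * 0ℚ * d         ≡⟨ zero* (ℚ.*-zeroʳ (fromℤ (Δ y))) d ⟩
  0ℚ                           ∎)
  where
  open ≡-Reasoning
  d : ℚ
  d = inv (fromℤ (poch (+ T ℤ.- + t) N ℤ.* Δ x))

P-S--nonneg : ∀ N T S t x y → In𝒳 N T (suc S) t x → In𝒳 N T S t y → 0ℚ ℚ.≤ P-S- N T (suc S) t x y
P-S--nonneg N T S t x y (_ , x-inc) (y∈ , y-inc) = subst (0ℚ ℚ.≤_) (sym (P-S--factored N T S t x y x-inc))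
  (*-nonneg (*-nonneg (ℚ.<⇒≤ (fromℤ-pos (Δ-pos y y-inc)))
                      (fromℤ-nonneg (∏ℤ-nonneg λ i → w₂-nonneg N T S t (In𝔛⇒Bounds (y∈ i)))))
            (ℚ.<⇒≤ (*-pos (inv-pos (pochₛ-pos N S)) (inv-pos (fromℤ-pos (Δ-pos x x-inc))))))

P-S--pos : ∀ N T S t x y → In𝒳 N T (suc S) t x → In𝒳 N T S t y →
  (∀ i → lookup y i ≡ lookup x i ℤ.- + 1 ⊎ lookup y i ≡ lookup x i) → 0ℚ ℚ.< P-S- N T (suc S) t x y
P-S--pos N T S t x y (_ , x-inc) (y∈ , y-inc) step = subst (0ℚ ℚ.<_) (sym (P-S--factored N T S t x y x-inc))
  (*-pos (*-pos (fromℤ-pos (Δ-pos y y-inc))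
                (fromℤ-pos (∏ℤ-pos λ i → w₂-step N T S t (In𝔛⇒Bounds (y∈ i)) (step i))))
         (*-pos (inv-pos (pochₛ-pos N S)) (inv-pos (fromℤ-pos (Δ-pos x x-inc)))))

-- Families of paths

packed : ∀ N → ℤ → Config N
packed N c = tabulate λ i → c ℤ.+ + toℕ i

lookup-packed : ∀ {N} c (i : Fin N) → lookup (packed N c) i ≡ c ℤ.+ + toℕ i
lookup-packed c i = Vec.lookup∘tabulate (λ i → c ℤ.+ + toℕ i) i

lookup⇒packed : ∀ {N} c (x : Config N) → (∀ i → lookup x i ≡ c ℤ.+ + toℕ i) → x ≡ packed N c
lookup⇒packed c x eq = trans (sym (Vec.tabulate∘lookup x)) (Vec.tabulate-cong eq)

packed-increasing : ∀ N c → Increasing (packed N c)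
packed-increasing N c i j i<j = subst₂ ℤ._<_ (sym (lookup-packed c i)) (sym (lookup-packed c j))
  (ℤ.+-monoʳ-< c (ℤ.+<+ i<j))

-- N increasing integers in an interval of N integers fill it: xᵢ - i (counting i from 0) is
-- nondecreasing, starts at or above c and ends at or below c.
confined⇒packed : ∀ {N} c (x : Config N) → Increasing x →
  (∀ i → c ℤ.≤ lookup x i) → (∀ i → lookup x i ℤ.≤ c ℤ.+ + N ℤ.- + 1) → x ≡ packed N c
confined⇒packed {zero}  c []  inc lo hi = refl
confined⇒packed {suc n} c x inc lo hi = lookup⇒packed c x λ i →
  unshift i (ℤ.≤-antisym (ℤ.≤-trans (proj₂ (between i)) upper) (ℤ.≤-trans lower (proj₁ (between i))))
  where
  f : Fin (suc n) → ℤ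
  f i = lookup x i ℤ.- + toℕ i

  between : ∀ i → f zero ℤ.≤ f i × f i ℤ.≤ f (fromℕ n)
  between = monotone-bounds f λ i → ℤ.0≤i-j⇒j≤i (resp-nonneg
    (<⇒0≤-pred (inc (inject₁ i) (suc i) (subst (ℕ._< suc (toℕ i)) (sym (Fin.toℕ-inject₁ i)) ℕ.≤-refl)))
    (trans (lem (lookup x (suc i)) (lookup x (inject₁ i)) (+ toℕ i))
      (cong (λ k → f (suc i) ℤ.- (lookup x (inject₁ i) ℤ.- + k)) (sym (Fin.toℕ-inject₁ i)))))
    where
    lem : ∀ a b i → a ℤ.- b ℤ.- + 1 ≡ a ℤ.- (+ 1 ℤ.+ i) ℤ.- (b ℤ.- i)
    lem = solve-∀

  unshift : ∀ i → f i ≡ c → lookup x i ≡ c ℤ.+ + toℕ i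
  unshift i eq = trans (i-j≡k⇒i≡j+k (lookup x i) (+ toℕ i) eq) (ℤ.+-comm (+ toℕ i) c)

  lower : c ℤ.≤ f zero
  lower = subst (c ℤ.≤_) (sym (ℤ.+-identityʳ (lookup x zero))) (lo zero)

  upper : f (fromℕ n) ℤ.≤ c
  upper = ℤ.0≤i-j⇒j≤i (resp-nonneg (ℤ.i≤j⇒0≤j-i (hi (fromℕ n)))
    (trans (lem c (+ n) (lookup x (fromℕ n))) (cong (λ k → c ℤ.- (lookup x (fromℕ n) ℤ.- + k)) (sym (Fin.toℕ-fromℕ n)))))
    where
    lem : ∀ c n a → c ℤ.+ (+ 1 ℤ.+ n) ℤ.- + 1 ℤ.- a ≡ c ℤ.- (a ℤ.- n)
    lem = solve-∀

-- At time 0 the bounds x ≥ 0 and x < t + N leave N points, and at time T the bounds x ≥ t + S - T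
-- and x < S + N do; so 𝒳 is a single configuration at both ends.
In𝒳-start : ∀ {N T S} x → In𝒳 N T S 0 x → x ≡ packed N (+ 0)
In𝒳-start {N} {T} {S} x (x∈ , inc) = confined⇒packed (+ 0) x inc
  (λ i → Bounds.x≥0 (In𝔛⇒Bounds {N} {T} {S} {0} (x∈ i)))
  (λ i → ℤ.0≤i-j⇒j≤i (Bounds.x<t+N (In𝔛⇒Bounds {N} {T} {S} {0} (x∈ i))))

In𝒳-end : ∀ {N T S} x → In𝒳 N T S T x → x ≡ packed N (+ S)
In𝒳-end {N} {T} {S} x (x∈ , inc) = confined⇒packed (+ S) x inc
  (λ i → ℤ.0≤i-j⇒j≤i (resp-nonneg (Bounds.x≥t+S-T (In𝔛⇒Bounds {N} {T} {S} {T} (x∈ i))) (lem (lookup x i) (+ T) (+ S))))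
  (λ i → ℤ.0≤i-j⇒j≤i (Bounds.x<S+N (In𝔛⇒Bounds {N} {T} {S} {T} (x∈ i))))
  where
  lem : ∀ x T S → x ℤ.+ T ℤ.- T ℤ.- S ≡ x ℤ.- S
  lem = solve-∀

-- The two monotonicities of a path, of τ(t) and of t − τ(t), give the four bounds.
path-bounds : ∀ N T S (i : Fin N) (τ : Fin (suc T) → ℤ) → τ zero ≡ + toℕ i → τ (fromℕ T) ≡ + S ℤ.+ + toℕ i →
  (∀ t → τ (suc t) ℤ.- τ (inject₁ t) ≡ + 0 ⊎ τ (suc t) ℤ.- τ (inject₁ t) ≡ + 1) →
  ∀ t → Bounds N T S (toℕ t) (τ t)
path-bounds N T S i τ start end step t = bounds
  (resp-nonneg (+-nonneg (ℤ.i≤j⇒0≤j-i τ₀≤) (ℤ.+≤+ {n = toℕ i} ℕ.z≤n))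
    (trans (cong (λ a → τ t ℤ.- a ℤ.+ + toℕ i) start) (lem₁ (τ t) (+ toℕ i))))
  (resp-nonneg (+-nonneg (ℤ.i≤j⇒0≤j-i ≤σ₁) (ℤ.+≤+ {n = toℕ i} ℕ.z≤n))
    (trans (cong₂ (λ a b → + a ℤ.- b ℤ.- σ t ℤ.+ + toℕ i) (Fin.toℕ-fromℕ T) end)
      (lem₂ (τ t) (+ toℕ i) (+ T) (+ S) (+ toℕ t))))
  (resp-nonneg (+-nonneg (ℤ.i≤j⇒0≤j-i σ₀≤) i<N)
    (trans (cong (λ a → σ t ℤ.- (+ 0 ℤ.- a) ℤ.+ (+ N ℤ.- + toℕ i ℤ.- + 1)) start) (lem₃ (τ t) (+ toℕ i) (+ toℕ t) (+ N))))
  (resp-nonneg (+-nonneg (ℤ.i≤j⇒0≤j-i ≤τ₁) i<N)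
    (trans (cong (λ a → a ℤ.- τ t ℤ.+ (+ N ℤ.- + toℕ i ℤ.- + 1)) end) (lem₄ (τ t) (+ toℕ i) (+ S) (+ N))))
  where
  σ : Fin (suc T) → ℤ
  σ t = + toℕ t ℤ.- τ t

  i<N : + 0 ℤ.≤ + N ℤ.- + toℕ i ℤ.- + 1
  i<N = <⇒0≤-pred (ℤ.+<+ (Fin.toℕ<n i))

  τ-mono : ∀ t → τ (inject₁ t) ℤ.≤ τ (suc t)
  τ-mono t with step t
  ... | inj₁ eq = ℤ.0≤i-j⇒j≤i (resp-nonneg ℤ.≤-refl (sym eq))
  ... | inj₂ eq = ℤ.0≤i-j⇒j≤i (resp-nonneg 0≤1 (sym eq))

  σ-mono : ∀ t → σ (inject₁ t) ℤ.≤ σ (suc t)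
  σ-mono t = ℤ.0≤i-j⇒j≤i (resp-nonneg (gain (step t))
    (trans (lem (τ (suc t)) (τ (inject₁ t)) (+ toℕ t))
      (cong (λ k → σ (suc t) ℤ.- (+ k ℤ.- τ (inject₁ t))) (sym (Fin.toℕ-inject₁ t)))))
    where
    gain : ∀ {δ} → δ ≡ + 0 ⊎ δ ≡ + 1 → + 0 ℤ.≤ + 1 ℤ.- δ
    gain (inj₁ refl) = 0≤1
    gain (inj₂ refl) = ℤ.≤-refl
    lem : ∀ a b t → + 1 ℤ.- (a ℤ.- b) ≡ + 1 ℤ.+ t ℤ.- a ℤ.- (t ℤ.- b)
    lem = solve-∀

  τ₀≤ : τ zero ℤ.≤ τ t
  τ₀≤ = proj₁ (monotone-bounds τ τ-mono t)
  ≤τ₁ : τ t ℤ.≤ τ (fromℕ T)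
  ≤τ₁ = proj₂ (monotone-bounds τ τ-mono t)
  σ₀≤ : σ zero ℤ.≤ σ t
  σ₀≤ = proj₁ (monotone-bounds σ σ-mono t)
  ≤σ₁ : σ t ℤ.≤ σ (fromℕ T)
  ≤σ₁ = proj₂ (monotone-bounds σ σ-mono t)

  lem₁ : ∀ a i → a ℤ.- i ℤ.+ i ≡ a
  lem₁ = solve-∀
  lem₂ : ∀ a i T S t → T ℤ.- (S ℤ.+ i) ℤ.- (t ℤ.- a) ℤ.+ i ≡ a ℤ.+ T ℤ.- t ℤ.- S
  lem₂ = solve-∀
  lem₃ : ∀ a i t N → t ℤ.- a ℤ.- (+ 0 ℤ.- i) ℤ.+ (N ℤ.- i ℤ.- + 1) ≡ t ℤ.+ N ℤ.- + 1 ℤ.- a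
  lem₃ = solve-∀
  lem₄ : ∀ a i S N → S ℤ.+ i ℤ.- a ℤ.+ (N ℤ.- i ℤ.- + 1) ≡ S ℤ.+ N ℤ.- + 1 ℤ.- a
  lem₄ = solve-∀

InΩ⇒In𝒳 : ∀ {N T S X} → InΩ N T S X → ∀ t → In𝒳 N T S (toℕ t) (lookup X t)
InΩ⇒In𝒳 {N} {T} {S} {X} (mkInΩ start end step inc) t =
  (λ i → Bounds⇒In𝔛 (path-bounds N T S i (λ t → lookup (lookup X t) i) (start i) (end i) (λ t → step t i) t)) , inc t

InΩ⇒Step : ∀ {N T S X} → InΩ N T S X → ∀ t → Step (lookup X (inject₁ t)) (lookup X (suc t))
InΩ⇒Step {X = X} X∈ t i with InΩ.step X∈ t i
... | inj₁ eq = inj₂ (i-j≡0⇒i≡j eq)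
... | inj₂ eq = inj₁ (i-j≡k⇒i≡j+k (lookup (lookup X (suc t)) i) (lookup (lookup X (inject₁ t)) i) eq)

-- The prescribed end points need no separate condition, being the only elements of 𝒳 at times 0 and
-- T. Thus Ω is cut out of the product of the 𝒳 by the step relation alone.
In𝒳∧Step⇒InΩ : ∀ {N T S X} → (∀ t → In𝒳 N T S (toℕ t) (lookup X t)) →
  (∀ t → Step (lookup X (inject₁ t)) (lookup X (suc t))) → InΩ N T S X
In𝒳∧Step⇒InΩ {N} {T} {S} {X} X∈ steps = mkInΩ
  (λ i → trans (cong (λ x → lookup x i) (In𝒳-start {N} {T} {S} (lookup X zero) (X∈ zero))) (lookup-packed (+ 0) i))
  (λ i → trans (cong (λ x → lookup x i)
    (In𝒳-end {N} {T} {S} (lookup X (fromℕ T))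
      (subst (λ k → In𝒳 N T S k (lookup X (fromℕ T))) (Fin.toℕ-fromℕ T) (X∈ (fromℕ T)))))
    (lookup-packed (+ S) i))
  (λ t i → case steps t i of λ where
    (inj₁ eq) → inj₂ (i≡j+k⇒i-j≡k (lookup (lookup X (inject₁ t)) i) (+ 1) eq)
    (inj₂ eq) → inj₁ (ℤ.i≡j⇒i-j≡0 eq))
  (λ t → proj₂ (X∈ t))

packed-start : ∀ N T S → S ℕ.≤ T → In𝒳 N T S 0 (packed N (+ 0))
packed-start N T S S≤T = (λ i → Bounds⇒In𝔛 (subst (Bounds N T S 0) (sym (lookup-packed (+ 0) i)) (bounds
  (ℤ.+≤+ ℕ.z≤n)
  (resp-nonneg (+-nonneg (ℤ.i≤j⇒0≤j-i (ℤ.+≤+ S≤T)) (ℤ.+≤+ {n = toℕ i} ℕ.z≤n)) (lem₁ (+ T) (+ S) (+ toℕ i)))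
  (resp-nonneg (i<N i) (lem₂ (+ N) (+ toℕ i)))
  (resp-nonneg (+-nonneg (i<N i) (ℤ.+≤+ {n = S} ℕ.z≤n)) (lem₃ (+ N) (+ S) (+ toℕ i)))))) , packed-increasing N (+ 0)
  where
  i<N : ∀ (i : Fin N) → + 0 ℤ.≤ + N ℤ.- + toℕ i ℤ.- + 1
  i<N i = <⇒0≤-pred (ℤ.+<+ (Fin.toℕ<n i))
  lem₁ : ∀ T S i → T ℤ.- S ℤ.+ i ≡ i ℤ.+ T ℤ.- + 0 ℤ.- S
  lem₁ = solve-∀
  lem₂ : ∀ N i → N ℤ.- i ℤ.- + 1 ≡ + 0 ℤ.+ N ℤ.- + 1 ℤ.- i
  lem₂ = solve-∀
  lem₃ : ∀ N S i → N ℤ.- i ℤ.- + 1 ℤ.+ S ≡ S ℤ.+ N ℤ.- + 1 ℤ.- i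
  lem₃ = solve-∀

packed-end : ∀ N T S → S ℕ.≤ T → In𝒳 N T S T (packed N (+ S))
packed-end N T S S≤T = (λ i → Bounds⇒In𝔛 (subst (Bounds N T S T) (sym (lookup-packed (+ S) i)) (bounds
  (ℤ.+≤+ ℕ.z≤n)
  (resp-nonneg (ℤ.+≤+ {n = toℕ i} ℕ.z≤n) (lem₁ (+ T) (+ S) (+ toℕ i)))
  (resp-nonneg (+-nonneg (i<N i) (ℤ.i≤j⇒0≤j-i (ℤ.+≤+ S≤T))) (lem₂ (+ T) (+ N) (+ S) (+ toℕ i)))
  (resp-nonneg (i<N i) (lem₃ (+ N) (+ S) (+ toℕ i)))))) , packed-increasing N (+ S)
  where
  i<N : ∀ (i : Fin N) → + 0 ℤ.≤ + N ℤ.- + toℕ i ℤ.- + 1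
  i<N i = <⇒0≤-pred (ℤ.+<+ (Fin.toℕ<n i))
  lem₁ : ∀ T S i → i ≡ S ℤ.+ i ℤ.+ T ℤ.- T ℤ.- S
  lem₁ = solve-∀
  lem₂ : ∀ T N S i → N ℤ.- i ℤ.- + 1 ℤ.+ (T ℤ.- S) ≡ T ℤ.+ N ℤ.- + 1 ℤ.- (S ℤ.+ i)
  lem₂ = solve-∀
  lem₃ : ∀ N S i → N ℤ.- i ℤ.- + 1 ≡ S ℤ.+ N ℤ.- + 1 ℤ.- (S ℤ.+ i)
  lem₃ = solve-∀

-- The product of P-t+ along a path

-- The absolute value makes it positive everywhere; the recursion is used only at positive
-- arguments.
factorial : ℤ → ℤ
factorial n = + (ℤ.∣ n ∣ !)

factorial-pos : ∀ n → + 0 ℤ.< factorial n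
factorial-pos n = ℤ.+<+ (ℕ.1≤n! ℤ.∣ n ∣)

factorial-suc : ∀ n → + 0 ℤ.< n → n ℤ.* factorial (n ℤ.- + 1) ≡ factorial n
factorial-suc (+ suc n) _ = sym (ℤ.pos-* (suc n) (n !))
factorial-suc (+ zero) (ℤ.+<+ ())

-- An up step lowers the first argument by one and keeps the second; a flat step does the reverse.
-- The factorial thereby loses precisely the factor `w₁`, so along steps `w₁` is a ratio of values
-- of φ.
φ : (N T S t : ℕ) → ℤ → ℤ
φ N T S t x = factorial (+ S ℤ.+ + N ℤ.- + 1 ℤ.- x) ℤ.* factorial (x ℤ.+ + T ℤ.- + t ℤ.- + S)

Φ : ∀ N (T S t : ℕ) → Config N → ℤ
Φ N T S t x = ∏ℤ λ i → φ N T S t (lookup x i)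

Φ-pos : ∀ N T S t x → + 0 ℤ.< Φ N T S t x
Φ-pos N T S t x = ∏ℤ-pos {f = λ i → φ N T S t (lookup x i)} λ i → φ-pos (lookup x i)
  where
  φ-pos : ∀ x → + 0 ℤ.< φ N T S t x
  φ-pos x = subst (ℤ._< a ℤ.* b) (ℤ.*-zeroʳ a)
    (ℤ.*-monoˡ-<-pos a {{ℤ.positive (factorial-pos (+ S ℤ.+ + N ℤ.- + 1 ℤ.- x))}}
      (factorial-pos (x ℤ.+ + T ℤ.- + t ℤ.- + S)))
    where
    a b : ℤ
    a = factorial (+ S ℤ.+ + N ℤ.- + 1 ℤ.- x)
    b = factorial (x ℤ.+ + T ℤ.- + t ℤ.- + S)

w₁-φ : ∀ N T S t {x y} → Bounds N T S (suc t) y → y ≡ x ℤ.+ + 1 ⊎ y ≡ x →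
       w₁ N T S t x y ℤ.* φ N T S (suc t) y ≡ φ N T S t x
w₁-φ N T S t {x} (bounds _ _ _ d) (inj₁ refl) = begin
  w₁ N T S t x (x ℤ.+ + 1) ℤ.* φ N T S (suc t) (x ℤ.+ + 1)
    ≡⟨ cong₂ ℤ._*_ (trans (w₁-up N T S t x) (lem₁ x (+ N) (+ S)))
         (cong₂ (λ u v → factorial u ℤ.* factorial v) (lem₂ x (+ N) (+ S)) (lem₃ x (+ T) (+ t) (+ S))) ⟩
  a ℤ.* (factorial (a ℤ.- + 1) ℤ.* factorial b) ≡⟨ ℤ.*-assoc a (factorial (a ℤ.- + 1)) (factorial b) ⟨
  a ℤ.* factorial (a ℤ.- + 1) ℤ.* factorial b
    ≡⟨ cong (ℤ._* factorial b) (factorial-suc a (pred-nonneg⇒pos (resp-nonneg d (lem₂ x (+ N) (+ S))))) ⟩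
  factorial a ℤ.* factorial b ∎
  where
  open ≡-Reasoning
  a b : ℤ
  a = + S ℤ.+ + N ℤ.- + 1 ℤ.- x
  b = x ℤ.+ + T ℤ.- + t ℤ.- + S
  lem₁ : ∀ x N S → N ℤ.+ S ℤ.- x ℤ.- + 1 ≡ S ℤ.+ N ℤ.- + 1 ℤ.- x
  lem₁ = solve-∀
  lem₂ : ∀ x N S → S ℤ.+ N ℤ.- + 1 ℤ.- (x ℤ.+ + 1) ≡ S ℤ.+ N ℤ.- + 1 ℤ.- x ℤ.- + 1
  lem₂ = solve-∀
  lem₃ : ∀ x T t S → x ℤ.+ + 1 ℤ.+ T ℤ.- (+ 1 ℤ.+ t) ℤ.- S ≡ x ℤ.+ T ℤ.- t ℤ.- S
  lem₃ = solve-∀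
w₁-φ N T S t {x} (bounds _ b′ _ _) (inj₂ refl) = begin
  w₁ N T S t x x ℤ.* φ N T S (suc t) x
    ≡⟨ cong₂ ℤ._*_ (w₁-flat N T S t x) (cong (λ v → factorial a ℤ.* factorial v) (lem₁ x (+ T) (+ t) (+ S))) ⟩
  b ℤ.* (factorial a ℤ.* factorial (b ℤ.- + 1)) ≡⟨ lem₂ b (factorial a) (factorial (b ℤ.- + 1)) ⟩
  factorial a ℤ.* (b ℤ.* factorial (b ℤ.- + 1))
    ≡⟨ cong (factorial a ℤ.*_) (factorial-suc b (pred-nonneg⇒pos (resp-nonneg b′ (lem₁ x (+ T) (+ t) (+ S))))) ⟩
  factorial a ℤ.* factorial b ∎
  where
  open ≡-Reasoning
  a b : ℤ
  a = + S ℤ.+ + N ℤ.- + 1 ℤ.- x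
  b = x ℤ.+ + T ℤ.- + t ℤ.- + S
  lem₁ : ∀ x T t S → x ℤ.+ T ℤ.- (+ 1 ℤ.+ t) ℤ.- S ≡ x ℤ.+ T ℤ.- t ℤ.- S ℤ.- + 1
  lem₁ = solve-∀
  lem₂ : ∀ a b c → a ℤ.* (b ℤ.* c) ≡ b ℤ.* (a ℤ.* c)
  lem₂ = solve-∀

-- P-t+ is, up to a constant, the Doob transform of the step relation by this function.
h : ∀ N (T S t : ℕ) → Config N → ℚ
h N T S t x = fromℤ (Δ x) * inv (fromℤ (Φ N T S t x))

h-pos : ∀ N T S t x → Increasing x → 0ℚ ℚ.< h N T S t x
h-pos N T S t x inc = *-pos (fromℤ-pos (Δ-pos x inc)) (inv-pos (fromℤ-pos (Φ-pos N T S t x)))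

-- Along a step `W₁` equals Φ(x) / Φ(y), and the normal form of `P-t+` supplies Δ(y) / Δ(x); apart
-- from the Pochhammer constant the entry is therefore h(y) / h(x).
P-t+-h : ∀ N T S t → t ℕ.< T → ∀ x y → In𝒳 N T S t x → In𝒳 N T S (suc t) y → Step x y →
  P-t+ N T S t x y * fromℤ (poch (+ T ℤ.- + t) N) * h N T S t x ≡ h N T S (suc t) y
P-t+-h N T S t t<T x y (_ , x-inc) (y∈ , y-inc) step = begin
  P-t+ N T S t x y * p * (dx * inv a)
    ≡⟨ cong (λ z → z * p * (dx * inv a)) (P-t+-factored N T S t t<T x y x-inc) ⟩
  dy * w * (inv p * inv dx) * p * (dx * inv a)
    ≡⟨ cong (λ z → dy * w * (inv p * inv dx) * p * (dx * z)) (trans (cong inv a≡wb) (inv-* w≢0 b≢0)) ⟩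
  dy * w * (inv p * inv dx) * p * (dx * (inv w * inv b))
    ≡⟨ solve 8 (λ dy w ip idx p dx iw ib → dy :* w :* (ip :* idx) :* p :* (dx :* (iw :* ib))
         := (p :* ip) :* ((dx :* idx) :* ((w :* iw) :* (dy :* ib)))) refl dy w (inv p) (inv dx) p dx (inv w) (inv b) ⟩
  (p * inv p) * ((dx * inv dx) * ((w * inv w) * (dy * inv b)))
    ≡⟨ trans (one* (*-inv (>⇒≢0 (pochₜ-pos N T t<T))) _) (trans (one* (*-inv (Δ≢0 x x-inc)) _) (one* (*-inv w≢0) _)) ⟩
  dy * inv b ∎
  where
  open ≡-Reasoning
  p dx dy w a b : ℚ
  p = fromℤ (poch (+ T ℤ.- + t) N)
  dx = fromℤ (Δ x)
  dy = fromℤ (Δ y)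
  w = fromℤ (W₁ N T S t x y)
  a = fromℤ (Φ N T S t x)
  b = fromℤ (Φ N T S (suc t) y)

  y-bounds : ∀ i → Bounds N T S (suc t) (lookup y i)
  y-bounds i = In𝔛⇒Bounds (y∈ i)

  w≢0 : w ≢ 0ℚ
  w≢0 = >⇒≢0 (fromℤ-pos (∏ℤ-pos λ i → w₁-step N T S t (y-bounds i) (step i)))

  b≢0 : b ≢ 0ℚ
  b≢0 = >⇒≢0 (fromℤ-pos (Φ-pos N T S (suc t) y))

  a≡wb : a ≡ w * b
  a≡wb = trans (cong fromℤ (trans (sym (ℤ∏.sum-cong-≗ λ i → w₁-φ N T S t (y-bounds i) (step i)))
    (ℤ∏.∑-distrib-+ (λ i → w₁ N T S t (lookup x i) (lookup y i)) (λ i → φ N T S (suc t) (lookup y i)))))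
    (fromℤ-* (W₁ N T S t x y) (Φ N T S (suc t) y))

∏-telescope : ∀ {n} (k : Fin n → ℚ) (a : Fin (suc n) → ℚ) → (∀ t → k t * a (inject₁ t) ≡ a (suc t)) →
              ∏ℚ k * a zero ≡ a (fromℕ n)
∏-telescope {zero}  k a step = ℚ.*-identityˡ (a zero)
∏-telescope {suc n} k a step = begin
  k zero * ∏ℚ (k ∘ suc) * a zero
    ≡⟨ solve 3 (λ a b c → a :* b :* c := b :* (a :* c)) refl (k zero) (∏ℚ (k ∘ suc)) (a zero) ⟩
  ∏ℚ (k ∘ suc) * (k zero * a zero)  ≡⟨ cong (∏ℚ (k ∘ suc) *_) (step zero) ⟩
  ∏ℚ (k ∘ suc) * a (suc zero)       ≡⟨ ∏-telescope (k ∘ suc) (a ∘ suc) (step ∘ suc) ⟩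
  a (fromℕ (suc n))                 ∎
  where open ≡-Reasoning

In𝒳-inject₁ : ∀ {N T S} (X : Family N T) → (∀ t → In𝒳 N T S (toℕ t) (lookup X t)) →
  ∀ t → In𝒳 N T S (toℕ t) (lookup X (inject₁ t))
In𝒳-inject₁ {N} {T} {S} X X∈ t =
  subst (λ k → In𝒳 N T S k (lookup X (inject₁ t))) (Fin.toℕ-inject₁ t) (X∈ (inject₁ t))

In𝒳-fromℕ : ∀ {N T S} (X : Family N T) → (∀ t → In𝒳 N T S (toℕ t) (lookup X t)) → In𝒳 N T S T (lookup X (fromℕ T))
In𝒳-fromℕ {N} {T} {S} X X∈ = subst (λ k → In𝒳 N T S k (lookup X (fromℕ T))) (Fin.toℕ-fromℕ T) (X∈ (fromℕ T))

weight : (N T S : ℕ) → ℚ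
weight N T S = h N T S T (packed N (+ S)) *
  inv (∏ℚ (λ (t : Fin T) → fromℤ (poch (+ T ℤ.- + toℕ t) N)) * h N T S 0 (packed N (+ 0)))

pochs-pos : ∀ N T → 0ℚ ℚ.< ∏ℚ (λ (t : Fin T) → fromℤ (poch (+ T ℤ.- + toℕ t) N))
pochs-pos N T = ∏ℚ-pos λ t → pochₜ-pos N T (Fin.toℕ<n t)

weight-pos : ∀ N T S → 0ℚ ℚ.< weight N T S
weight-pos N T S = *-pos (h-pos N T S T (packed N (+ S)) (packed-increasing N (+ S)))
  (inv-pos (*-pos (pochs-pos N T) (h-pos N T S 0 (packed N (+ 0)) (packed-increasing N (+ 0)))))

-- After multiplication by the Pochhammer constants the factors telescope to the quotient of h at
-- the two ends, and all families share their end configurations.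
∏-P-t+ : ∀ N T S X → InΩ N T S X →
  ∏ℚ (λ t → P-t+ N T S (toℕ t) (lookup X (inject₁ t)) (lookup X (suc t))) ≡ weight N T S
∏-P-t+ N T S X X∈Ω = *-cancelˡ z≢0 (begin
  z * ∏ℚ k                      ≡⟨ ℚ.*-comm z (∏ℚ k) ⟩
  ∏ℚ k * (∏ℚ p * h₀)            ≡⟨ ℚ.*-assoc (∏ℚ k) (∏ℚ p) h₀ ⟨
  ∏ℚ k * ∏ℚ p * h₀              ≡⟨ cong (_* h₀) (ℚ∏.∑-distrib-+ k p) ⟨
  ∏ℚ (λ t → k t * p t) * h₀
    ≡⟨ cong (λ x → ∏ℚ (λ t → k t * p t) * h N T S 0 x)
         (In𝒳-start {N} {T} {S} (lookup X zero) (X∈ zero)) ⟨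
  ∏ℚ (λ t → k t * p t) * a zero ≡⟨ ∏-telescope (λ t → k t * p t) a step ⟩
  a (fromℕ T)
    ≡⟨ cong₂ (h N T S) (Fin.toℕ-fromℕ T) (In𝒳-end {N} {T} {S} (lookup X (fromℕ T)) (In𝒳-fromℕ X X∈)) ⟩
  h₁                            ≡⟨ one* (*-inv z≢0) h₁ ⟨
  z * inv z * h₁                ≡⟨ solve 3 (λ a b c → a :* b :* c := a :* (c :* b)) refl z (inv z) h₁ ⟩
  z * (h₁ * inv z)              ∎)
  where
  open ≡-Reasoning
  X∈ : ∀ t → In𝒳 N T S (toℕ t) (lookup X t)
  X∈ = InΩ⇒In𝒳 X∈Ω
  k p : Fin T → ℚ
  k t = P-t+ N T S (toℕ t) (lookup X (inject₁ t)) (lookup X (suc t))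
  p t = fromℤ (poch (+ T ℤ.- + toℕ t) N)
  a : Fin (suc T) → ℚ
  a t = h N T S (toℕ t) (lookup X t)
  h₀ h₁ z : ℚ
  h₀ = h N T S 0 (packed N (+ 0))
  h₁ = h N T S T (packed N (+ S))
  z = ∏ℚ p * h₀

  z≢0 : z ≢ 0ℚ
  z≢0 = >⇒≢0 (*-pos (pochs-pos N T) (h-pos N T S 0 (packed N (+ 0)) (packed-increasing N (+ 0))))

  step : ∀ t → k t * p t * a (inject₁ t) ≡ a (suc t)
  step t = trans (cong (λ j → k t * p t * h N T S j (lookup X (inject₁ t))) (Fin.toℕ-inject₁ t))
    (P-t+-h N T S (toℕ t) (Fin.toℕ<n t) (lookup X (inject₁ t)) (lookup X (suc t))
      (In𝒳-inject₁ X X∈ t) (X∈ (suc t)) (InΩ⇒Step X∈Ω t))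

-- Sums over sequences

sequences : ∀ {A : Set} n → (ℕ → List A) → List (Vec A n)
sequences zero    B = [] ∷ []
sequences (suc n) B = cartesianProductWith _∷_ (B 0) (sequences n (B ∘ suc))

∈-sequences⁻ : ∀ {A : Set} n (B : ℕ → List A) {v} → v ∈ sequences n B → ∀ t → lookup v t ∈ B (toℕ t)
∈-sequences⁻ (suc n) B v∈ t with ∈-cartesianProductWith⁻ _∷_ (B 0) (sequences n (B ∘ suc)) v∈
∈-sequences⁻ (suc n) B v∈ zero    | _ , _ , x∈ , _  , refl = x∈
∈-sequences⁻ (suc n) B v∈ (suc t) | _ , _ , _  , v∈′ , refl = ∈-sequences⁻ n (B ∘ suc) v∈′ t

∈-sequences⁺ : ∀ {A : Set} n (B : ℕ → List A) v → (∀ t → lookup v t ∈ B (toℕ t)) → v ∈ sequences n B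
∈-sequences⁺ zero    B []      _ = here refl
∈-sequences⁺ (suc n) B (x ∷ v) h = ∈-cartesianProductWith⁺ _∷_ (h zero) (∈-sequences⁺ n (B ∘ suc) v (h ∘ suc))

sequences-unique : ∀ {A : Set} n (B : ℕ → List A) → (∀ t → Unique (B t)) → Unique (sequences n B)
sequences-unique zero    B u = [] ∷ []
sequences-unique (suc n) B u =
  Unique.cartesianProductWith⁺ _∷_ Vec.∷-injective (u 0) (sequences-unique n (B ∘ suc) (u ∘ suc))

-- The elements are summed out from the last to the first.
∑-sequences-forward : ∀ {A : Set} n (B : ℕ → List A) (K : Fin n → A → A → ℚ) (Good : Fin (suc n) → A → Set) →
  (∀ t {y} → y ∈ B (toℕ t) → Good (inject₁ t) y → ∑ (B (suc (toℕ t))) (K t y) ≡ 1ℚ) →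
  (∀ t {y y′} → K t y y′ ≢ 0ℚ → Good (suc t) y′) →
  ∀ {y} → y ∈ B 0 → Good zero y →
  ∑ (sequences n (B ∘ suc)) (λ v → ∏ℚ (λ t → K t (lookup (y ∷ v) (inject₁ t)) (lookup v t))) ≡ 1ℚ
∑-sequences-forward zero    B K Good total next y∈ good = refl
∑-sequences-forward (suc n) B K Good total next {y} y∈ good = begin
  ∑ (sequences (suc n) (B ∘ suc)) (λ v → ∏ℚ (λ t → K t (lookup (y ∷ v) (inject₁ t)) (lookup v t)))
    ≡⟨ ∑-cartesianProductWith _∷_ (B 1) (sequences n (λ t → B (suc (suc t)))) _ ⟩
  ∑ (B 1) (λ y′ → ∑ (sequences n (λ t → B (suc (suc t)))) (λ v → K zero y y′ * rest y′ v))
    ≡⟨ ∑-cong (B 1) (λ {y′} y′∈ → trans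
         (∑-*ˡ (sequences n (λ t → B (suc (suc t)))) (K zero y y′) (rest y′)) (factor y′ y′∈)) ⟩
  ∑ (B 1) (K zero y)
    ≡⟨ total zero y∈ good ⟩
  1ℚ ∎
  where
  open ≡-Reasoning
  rest : _ → Vec _ n → ℚ
  rest y′ v = ∏ℚ (λ t → K (suc t) (lookup (y′ ∷ v) (inject₁ t)) (lookup v t))

  -- The kernel is known to have total 1 only at good elements. A nonzero entry leads to a good one,
  -- and at a zero entry both sides vanish.
  factor : ∀ y′ → y′ ∈ B 1 → K zero y y′ * ∑ (sequences n (λ t → B (suc (suc t)))) (rest y′) ≡ K zero y y′
  factor y′ y′∈ with K zero y y′ ℚ.≟ 0ℚ
  ... | yes eq = trans (zero* eq _) (sym eq)
  ... | no ≢0  = trans (cong (K zero y y′ *_)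
    (∑-sequences-forward n (B ∘ suc) (K ∘ suc) (Good ∘ suc) (total ∘ suc) (next ∘ suc) y′∈ (next zero ≢0)))
    (ℚ.*-identityʳ (K zero y y′))

-- The elements are summed out from the first to the last.
∑-sequences-backward : ∀ {A : Set} n (B : ℕ → List A) (K : Fin n → A → A → ℚ) (e : A → ℚ) (Good : Fin (suc n) → A → Set) →
  (∀ t {x′} → x′ ∈ B (suc (toℕ t)) → Good (suc t) x′ → ∑ (B (toℕ t)) (λ x → K t x x′) ≡ 1ℚ) →
  (∀ t {x x′} → K t x x′ ≢ 0ℚ → Good (inject₁ t) x) → (∀ {x} → e x ≢ 0ℚ → Good (fromℕ n) x) →
  ∑ (sequences (suc n) B) (λ v → ∏ℚ (λ t → K t (lookup v (inject₁ t)) (lookup v (suc t))) * e (lookup v (fromℕ n)))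
  ≡ ∑ (B n) e
∑-sequences-backward zero B K e Good total prev end =
  trans (∑-cartesianProductWith _∷_ (B 0) ([] ∷ []) _)
    (∑-cong (B 0) (λ {x} _ → trans (ℚ.+-identityʳ (1ℚ * e x)) (ℚ.*-identityˡ (e x))))
∑-sequences-backward (suc n) B K e Good total prev end = begin
  ∑ (sequences (suc (suc n)) B)
    (λ v → ∏ℚ (λ t → K t (lookup v (inject₁ t)) (lookup v (suc t))) * e (lookup v (fromℕ (suc n))))
    ≡⟨ ∑-cartesianProductWith _∷_ (B 0) V _ ⟩
  ∑ (B 0) (λ x → ∑ V (λ v → K zero x (lookup v zero) * ∏′ v * e′ v))
    -- The first element occurs only in the first kernel factor, so it can be summed out against the
    -- second element alone.
    ≡⟨ ∑-swap (B 0) V (λ x v → K zero x (lookup v zero) * ∏′ v * e′ v) ⟩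
  ∑ V (λ v → ∑ (B 0) (λ x → K zero x (lookup v zero) * ∏′ v * e′ v))
    ≡⟨ ∑-cong V (λ {v} v∈ → trans
         (∑-cong (B 0) λ {x} _ → ℚ.*-assoc (K zero x (lookup v zero)) (∏′ v) (e′ v))
         (trans (∑-*ʳ (B 0) (∏′ v * e′ v) (λ x → K zero x (lookup v zero))) (factor v v∈))) ⟩
  ∑ V (λ v → ∏′ v * e′ v)
    ≡⟨ ∑-sequences-backward n (B ∘ suc) (K ∘ suc) e (Good ∘ suc) (total ∘ suc) (prev ∘ suc) end ⟩
  ∑ (B (suc n)) e ∎
  where
  open ≡-Reasoning
  V : List (Vec _ (suc n))
  V = sequences (suc n) (B ∘ suc)
  ∏′ e′ : Vec _ (suc n) → ℚ
  ∏′ v = ∏ℚ (λ t → K (suc t) (lookup v (inject₁ t)) (lookup v (suc t)))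
  e′ v = e (lookup v (fromℕ n))

  -- The first element of v is good because of the next kernel factor or, when none is left, because
  -- of e.
  good : ∀ {m} (K : Fin m → _ → _ → ℚ) (Good : Fin (suc m) → _ → Set) →
    (∀ t {x x′} → K t x x′ ≢ 0ℚ → Good (inject₁ t) x) → (∀ {x} → e x ≢ 0ℚ → Good (fromℕ m) x) →
    ∀ v → ∏ℚ (λ t → K t (lookup v (inject₁ t)) (lookup v (suc t))) ≢ 0ℚ → e (lookup v (fromℕ m)) ≢ 0ℚ →
    Good zero (lookup v zero)
  good {zero}  K Good prev end v _    e≢0 = end e≢0
  good {suc m} K Good prev end v ∏≢0 _   =
    prev zero (λ eq → ∏≢0 (∏ℚ-0 {f = λ t → K t (lookup v (inject₁ t)) (lookup v (suc t))} zero eq))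

  c : Vec _ (suc n) → ℚ
  c v = ∑ (B 0) (λ x → K zero x (lookup v zero))

  vanish : ∀ {v a} → a ≡ 0ℚ → c v * a ≡ a
  vanish {v} refl = ℚ.*-zeroʳ (c v)

  factor : ∀ v → v ∈ V → c v * (∏′ v * e′ v) ≡ ∏′ v * e′ v
  factor v v∈ with ∏′ v ℚ.≟ 0ℚ | e′ v ℚ.≟ 0ℚ
  ... | no ∏≢0 | no e≢0 = one* (total zero (∈-sequences⁻ (suc n) (B ∘ suc) v∈ zero)
    (good (K ∘ suc) (Good ∘ suc) (prev ∘ suc) end v ∏≢0 e≢0)) (∏′ v * e′ v)
  ... | yes ∏≡0 | _       = vanish {v} (zero* ∏≡0 (e′ v))
  ... | no _    | yes e≡0 = vanish {v} (trans (cong (∏′ v *_) e≡0) (ℚ.*-zeroʳ (∏′ v)))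

-- The matrix P-S↦S+1

∏ℚ-≢0 : ∀ {n} (f : Fin n → ℚ) → ∏ℚ f ≢ 0ℚ → ∀ i → f i ≢ 0ℚ
∏ℚ-≢0 f ≢0 i eq = ≢0 (∏ℚ-0 {f = f} i eq)

*-≢0ˡ : ∀ p q → p * q ≢ 0ℚ → p ≢ 0ℚ
*-≢0ˡ p q ≢0 eq = ≢0 (zero* eq q)

*-≢0ʳ : ∀ p q → p * q ≢ 0ℚ → q ≢ 0ℚ
*-≢0ʳ p q ≢0 eq = ≢0 (trans (cong (p *_) eq) (ℚ.*-zeroʳ p))

-- A vanishing denominator already makes the product vanish, since p /₀ 0 = 0.
guard-redundant : ∀ {n} (num den : Fin n → ℚ) → (∀ t → 0ℚ ℚ.≤ den t) →
  (if does (0ℚ ℚ.<? ∏ℚ den) then ∏ℚ (λ t → num t /₀ den t) else 0ℚ) ≡ ∏ℚ (λ t → num t * inv (den t))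
guard-redundant {n} num den den≥0 =
  if-dec (0ℚ ℚ.<? ∏ℚ den) (λ _ → ℚ∏.sum-cong-≗ (λ t → /₀≡*inv (num t) (den t))) degenerate
  where
  degenerate : ¬ 0ℚ ℚ.< ∏ℚ den → 0ℚ ≡ ∏ℚ (λ t → num t * inv (den t))
  degenerate ≯0 with Fin.¬∀⟶∃¬ n (λ t → 0ℚ ℚ.< den t) (λ t → 0ℚ ℚ.<? den t) (≯0 ∘ ∏ℚ-pos)
  ... | t , den≯0 = sym (∏ℚ-0 {f = λ t → num t * inv (den t)} t
    (trans (cong (λ d → num t * inv d) (ℚ.≤-antisym (ℚ.≮⇒≥ den≯0) (den≥0 t))) (ℚ.*-zeroʳ (num t))))

_≟-Config_ : ∀ {N} → DecidableEquality (Config N)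
_≟-Config_ = Vec.≡-dec ℤ._≟_

_≟-Family_ : ∀ {N T} → DecidableEquality (Family N T)
_≟-Family_ = Vec.≡-dec _≟-Config_

-- A summand that vanishes off the step relation has the same sum over Ω as over the product of the
-- 𝒳, where it can be evaluated one time at a time.
∑-Ω : ∀ N T S (g : Family N T → ℚ) →
  (∀ X → g X ≢ 0ℚ → ∀ t → Step (lookup X (inject₁ t)) (lookup X (suc t))) →
  ∑ (Ω N T S) g ≡ ∑ (sequences (suc T) (𝒳 N T S)) g
∑-Ω N T S g steps = ∑-support _≟-Family_ (Ω-unique N T S)
  (sequences-unique (suc T) (𝒳 N T S) (𝒳-unique N T S)) g
  (λ {X} X∈ X∉ → contradiction
    (∈-sequences⁺ (suc T) (𝒳 N T S) X λ t → ∈𝒳⁺ N T S (toℕ t) (InΩ⇒In𝒳 {X = X} (∈Ω⁻ N T S X∈) t)) X∉)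
  (λ {X} X∈ X∉ → outside X X∈ X∉ (g X ℚ.≟ 0ℚ))
  where
  outside : ∀ X → X ∈ sequences (suc T) (𝒳 N T S) → X ∉ Ω N T S → Dec (g X ≡ 0ℚ) → g X ≡ 0ℚ
  outside X X∈ X∉ (yes eq) = eq
  outside X X∈ X∉ (no ≢0)  = contradiction
    (∈Ω⁺ N T S (In𝒳∧Step⇒InΩ {X = X} (λ t → ∈𝒳⁻ N T S (toℕ t) (∈-sequences⁻ (suc T) (𝒳 N T S) X∈ t)) (steps X ≢0))) X∉

module _ (N T S : ℕ) (S<T : S ℕ.< T) where

  private
    P₁ P₁⁺ : ℕ → Matrix (Config N) (Config N)
    P₁  t = P-t+ N T S t
    P₁⁺ t = P-t+ N T (suc S) t

    -- P-S- does not depend on its time argument.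
    P₂ : Matrix (Config N) (Config N)
    P₂ = P-S- N T (suc S) 0

    D : ℕ → Matrix (Config N) (Config N)
    D t = P₁⁺ t ⟨ 𝒳 N T (suc S) (suc t) ⟩ P₂

    P₂-nonneg : ∀ t y x → In𝒳 N T (suc S) t y → In𝒳 N T S t x → 0ℚ ℚ.≤ P₂ y x
    P₂-nonneg = P-S--nonneg N T S

    D-terms-nonneg : ∀ t → t ℕ.< T → ∀ y x → In𝒳 N T (suc S) t y → In𝒳 N T S (suc t) x →
      ∀ {y′} → y′ ∈ 𝒳 N T (suc S) (suc t) → 0ℚ ℚ.≤ P₁⁺ t y y′ * P₂ y′ x
    D-terms-nonneg t t<T y x y∈ x∈ {y′} y′∈ = *-nonneg
      (P-t+-nonneg N T (suc S) t t<T y y′ y∈ (∈𝒳⁻ N T (suc S) (suc t) y′∈))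
      (P₂-nonneg (suc t) y′ x (∈𝒳⁻ N T (suc S) (suc t) y′∈) x∈)

    D-nonneg : ∀ t → t ℕ.< T → ∀ y x → In𝒳 N T (suc S) t y → In𝒳 N T S (suc t) x → 0ℚ ℚ.≤ D t y x
    D-nonneg t t<T y x y∈ x∈ = ∑-nonneg (𝒳 N T (suc S) (suc t)) (D-terms-nonneg t t<T y x y∈ x∈)

    -- The form needed for columns: y′ = Y(t + 1) is given and contributes a positive term to `D`.
    D-pos : ∀ t → t ℕ.< T → ∀ y y′ x → In𝒳 N T (suc S) t y → In𝒳 N T (suc S) (suc t) y′ → In𝒳 N T S (suc t) x →
      Step y y′ → P₂ y′ x ≢ 0ℚ → 0ℚ ℚ.< D t y x
    D-pos t t<T y y′ x y∈ y′∈ x∈ step ≢0 =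
      ∑-pos (𝒳 N T (suc S) (suc t)) {x = y′} (D-terms-nonneg t t<T y x y∈ x∈) (∈𝒳⁺ N T (suc S) (suc t) y′∈)
        (*-pos (P-t+-pos N T (suc S) t t<T y y′ y∈ y′∈ step) (≥∧≢0⇒> (P₂-nonneg (suc t) y′ x y′∈ x∈) ≢0))

    D-commute : ∀ t → t ℕ.< T → ∀ y x → In𝒳 N T (suc S) t y → In𝒳 N T S (suc t) x →
      D t y x ≡ (P₂ ⟨ 𝒳 N T S t ⟩ P₁ t) y x
    D-commute t t<T y x y∈ (_ , x-inc) = commutation N T S t t<T y x y∈ x-inc

    -- The form needed for rows: no successor of y is available yet, but x = X(t) is an intermediate
    -- configuration of the product in the other order, and `D-commute` transfers its positive term.
    D-pos′ : ∀ t → t ℕ.< T → ∀ y x x′ → In𝒳 N T (suc S) t y → In𝒳 N T S t x → In𝒳 N T S (suc t) x′ →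
      Step x x′ → P₂ y x ≢ 0ℚ → 0ℚ ℚ.< D t y x′
    D-pos′ t t<T y x x′ y∈ x∈ x′∈ step ≢0 = subst (0ℚ ℚ.<_) (sym (D-commute t t<T y x′ y∈ x′∈))
      (∑-pos (𝒳 N T S t) {x = x}
        (λ {x″} x″∈ → *-nonneg (P₂-nonneg t y x″ y∈ (∈𝒳⁻ N T S t x″∈))
          (P-t+-nonneg N T S t t<T x″ x′ (∈𝒳⁻ N T S t x″∈) x′∈))
        (∈𝒳⁺ N T S t x∈)
        (*-pos (≥∧≢0⇒> (P₂-nonneg t y x y∈ x∈) ≢0) (P-t+-pos N T S t t<T x x′ x∈ x′∈ step)))

    t<T : ∀ (t : Fin T) → toℕ t ℕ.< T
    t<T = Fin.toℕ<n

    -- With X fixed, the law of Y(t + 1) given Y(t). Where `D` vanishes, inv 0 = 0 makes the whole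
    -- row zero, so total 1 is claimed only at rows with positive `D`.
    kernel : Family N T → Fin T → Config N → Config N → ℚ
    kernel X t y y′ = P₁⁺ (toℕ t) y y′ * P₂ y′ (lookup X (suc t)) * inv (D (toℕ t) y (lookup X (suc t)))

    P-product : ∀ X Y → InΩ N T S X → InΩ N T (suc S) Y →
      P-S↦S+1 N T S X Y ≡ ∏ℚ (λ t → kernel X t (lookup Y (inject₁ t)) (lookup Y (suc t)))
    P-product X Y X∈ Y∈ = guard-redundant
      (λ t → P₁⁺ (toℕ t) (lookup Y (inject₁ t)) (lookup Y (suc t)) * P₂ (lookup Y (suc t)) (lookup X (suc t)))
      (λ t → D (toℕ t) (lookup Y (inject₁ t)) (lookup X (suc t)))
      (λ t → D-nonneg (toℕ t) (t<T t) (lookup Y (inject₁ t)) (lookup X (suc t))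
        (In𝒳-inject₁ Y (InΩ⇒In𝒳 Y∈) t) (InΩ⇒In𝒳 X∈ (suc t)))

  P-nonneg : ∀ X Y → InΩ N T S X → InΩ N T (suc S) Y → 0ℚ ℚ.≤ P-S↦S+1 N T S X Y
  P-nonneg X Y X∈ Y∈ = subst (0ℚ ℚ.≤_) (sym (P-product X Y X∈ Y∈)) (∏ℚ-nonneg λ t → *-nonneg
    (D-terms-nonneg (toℕ t) (t<T t) (lookup Y (inject₁ t)) (lookup X (suc t)) (y∈ t) (InΩ⇒In𝒳 X∈ (suc t))
      {lookup Y (suc t)} (∈𝒳⁺ N T (suc S) (suc (toℕ t)) (InΩ⇒In𝒳 Y∈ (suc t))))
    (inv-nonneg (D-nonneg (toℕ t) (t<T t) (lookup Y (inject₁ t)) (lookup X (suc t)) (y∈ t) (InΩ⇒In𝒳 X∈ (suc t)))))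
    where
    y∈ : ∀ t → In𝒳 N T (suc S) (toℕ t) (lookup Y (inject₁ t))
    y∈ = In𝒳-inject₁ Y (InΩ⇒In𝒳 Y∈)

  -- Row sums

  private
    base : Config N
    base = packed N (+ 0)

    P₂-base : 0ℚ ℚ.< P₂ base base
    P₂-base = P-S--pos N T S 0 base base (packed-start N T (suc S) S<T) (packed-start N T S (ℕ.<⇒≤ S<T)) (λ _ → inj₂ refl)

  -- The invariant `Good` makes the denominator positive by `D-pos′`, and it reproduces itself
  -- because its next instance is a factor of the kernel. At time 0 both configurations are `base`,
  -- where the entry is positive.
  row-sum : ∀ X → InΩ N T S X → ∑ (Ω N T (suc S)) (P-S↦S+1 N T S X) ≡ 1ℚ
  row-sum X X∈Ω = begin
    ∑ (Ω N T (suc S)) (P-S↦S+1 N T S X)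
      ≡⟨ ∑-cong (Ω N T (suc S)) (λ {Y} Y∈ → P-product X Y X∈Ω (∈Ω⁻ N T (suc S) Y∈)) ⟩
    ∑ (Ω N T (suc S)) g
      ≡⟨ ∑-Ω N T (suc S) g steps ⟩
    ∑ (sequences (suc T) (𝒳 N T (suc S))) g
      ≡⟨ ∑-cartesianProductWith _∷_ (𝒳 N T (suc S) 0) (sequences T (𝒳 N T (suc S) ∘ suc)) g ⟩
    ∑ (𝒳 N T (suc S) 0) (λ y → ∑ (sequences T (𝒳 N T (suc S) ∘ suc)) (λ v → g (y ∷ v)))
      ≡⟨ ∑-cong (𝒳 N T (suc S) 0) (λ {y} y∈ →
           ∑-sequences-forward T (𝒳 N T (suc S)) (kernel X) Good total next y∈ (start y y∈)) ⟩
    ∑ (𝒳 N T (suc S) 0) (λ _ → 1ℚ)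
      ≡⟨ ∑-support _≟-Config_ (𝒳-unique N T (suc S) 0) ([] ∷ []) (λ _ → 1ℚ)
           (λ {y} y∈ y∉ → contradiction (here (In𝒳-start {N} {T} {suc S} y (∈𝒳⁻ N T (suc S) 0 y∈))) y∉)
           (λ { (here refl) y∉ → contradiction (∈𝒳⁺ N T (suc S) 0 (packed-start N T (suc S) S<T)) y∉ }) ⟩
    ∑ (base ∷ []) (λ _ → 1ℚ) ≡⟨⟩
    1ℚ ∎
    where
    open ≡-Reasoning
    X∈ : ∀ t → In𝒳 N T S (toℕ t) (lookup X t)
    X∈ = InΩ⇒In𝒳 X∈Ω

    g : Family N T → ℚ
    g Y = ∏ℚ (λ t → kernel X t (lookup Y (inject₁ t)) (lookup Y (suc t)))

    Good : Fin (suc T) → Config N → Set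
    Good t y = P₂ y (lookup X t) ≢ 0ℚ

    weight≢0 : ∀ t y y′ → kernel X t y y′ ≢ 0ℚ → P₁⁺ (toℕ t) y y′ * P₂ y′ (lookup X (suc t)) ≢ 0ℚ
    weight≢0 t y y′ = *-≢0ˡ (P₁⁺ (toℕ t) y y′ * P₂ y′ (lookup X (suc t))) (inv (D (toℕ t) y (lookup X (suc t))))

    steps : ∀ Y → g Y ≢ 0ℚ → ∀ t → Step (lookup Y (inject₁ t)) (lookup Y (suc t))
    steps Y ≢0 t = P-t+-≢0⇒Step N T (suc S) (toℕ t) (lookup Y (inject₁ t)) (lookup Y (suc t))
      (*-≢0ˡ (P₁⁺ (toℕ t) (lookup Y (inject₁ t)) (lookup Y (suc t))) (P₂ (lookup Y (suc t)) (lookup X (suc t)))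
        (weight≢0 t (lookup Y (inject₁ t)) (lookup Y (suc t))
          (∏ℚ-≢0 (λ t → kernel X t (lookup Y (inject₁ t)) (lookup Y (suc t))) ≢0 t)))

    total : ∀ t {y} → y ∈ 𝒳 N T (suc S) (toℕ t) → Good (inject₁ t) y → ∑ (𝒳 N T (suc S) (suc (toℕ t))) (kernel X t y) ≡ 1ℚ
    total t {y} y∈ good = trans
      (∑-*ʳ (𝒳 N T (suc S) (suc (toℕ t))) (inv (D (toℕ t) y (lookup X (suc t))))
        (λ y′ → P₁⁺ (toℕ t) y y′ * P₂ y′ (lookup X (suc t))))
      (*-inv (>⇒≢0 (D-pos′ (toℕ t) (t<T t) y (lookup X (inject₁ t)) (lookup X (suc t))
        (∈𝒳⁻ N T (suc S) (toℕ t) y∈) (In𝒳-inject₁ X X∈ t) (X∈ (suc t)) (InΩ⇒Step X∈Ω t) good)))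

    next : ∀ t {y y′} → kernel X t y y′ ≢ 0ℚ → Good (suc t) y′
    next t {y} {y′} ≢0 = *-≢0ʳ (P₁⁺ (toℕ t) y y′) (P₂ y′ (lookup X (suc t))) (weight≢0 t y y′ ≢0)

    start : ∀ y → y ∈ 𝒳 N T (suc S) 0 → Good zero y
    start y y∈ = subst₂ (λ a b → P₂ a b ≢ 0ℚ)
      (sym (In𝒳-start {N} {T} {suc S} y (∈𝒳⁻ N T (suc S) 0 y∈)))
      (sym (In𝒳-start {N} {T} {S} (lookup X zero) (X∈ zero))) (>⇒≢0 P₂-base)

  -- Column sums and the uniform measure

  private
    -- All Y end at `packed N (+ suc S)`, so this number is the same for every column; its
    -- positivity is all that is used of its value.
    end-mass : ℚ
    end-mass = ∑ (𝒳 N T S T) (P₂ (packed N (+ suc S)))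

    end-mass-pos : 0ℚ ℚ.< end-mass
    end-mass-pos = ∑-pos (𝒳 N T S T) {x = packed N (+ S)}
      (λ {x} x∈ → P₂-nonneg T (packed N (+ suc S)) x (packed-end N T (suc S) S<T) (∈𝒳⁻ N T S T x∈))
      (∈𝒳⁺ N T S T (packed-end N T S (ℕ.<⇒≤ S<T)))
      (P-S--pos N T S T (packed N (+ suc S)) (packed N (+ S)) (packed-end N T (suc S) S<T) (packed-end N T S (ℕ.<⇒≤ S<T))
        -- Here all N particles move down by one.
        (λ i → inj₁ (trans (lookup-packed (+ S) i) (trans (lem (+ S) (+ toℕ i))
          (cong (ℤ._- + 1) (sym (lookup-packed (+ suc S) i)))))))
      where
      lem : ∀ S i → S ℤ.+ i ≡ + 1 ℤ.+ S ℤ.+ i ℤ.- + 1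
      lem = solve-∀

    -- With Y fixed, the law of X(t) given X(t + 1) = x′: the numerators are the terms of the
    -- product in the other order, whose sum over x equals `D` by commutation.
    reverse-kernel : Family N T → Fin T → Config N → Config N → ℚ
    reverse-kernel Y t x x′ =
      P₂ (lookup Y (inject₁ t)) x * P₁ (toℕ t) x x′ * inv (D (toℕ t) (lookup Y (inject₁ t)) x′)

    -- The invariant travels backwards: the last factor makes the `P₂` entry at time T nonzero, and
    -- each kernel factor contains the entry at the preceding time. `D-pos` with Y(t + 1) as
    -- intermediate then gives total 1.
    ∑-reverse-kernel : ∀ Y → InΩ N T (suc S) Y →
      ∑ (Ω N T S) (λ X → ∏ℚ (λ t → reverse-kernel Y t (lookup X (inject₁ t)) (lookup X (suc t)))
                         * P₂ (lookup Y (fromℕ T)) (lookup X (fromℕ T))) ≡ end-mass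
    ∑-reverse-kernel Y Y∈Ω = begin
      ∑ (Ω N T S) g                        ≡⟨ ∑-Ω N T S g steps ⟩
      ∑ (sequences (suc T) (𝒳 N T S)) g
        ≡⟨ ∑-sequences-backward T (𝒳 N T S) (reverse-kernel Y) e Good total prev (λ ≢0 → ≢0) ⟩
      ∑ (𝒳 N T S T) e
        ≡⟨ cong (λ y → ∑ (𝒳 N T S T) (P₂ y)) (In𝒳-end {N} {T} {suc S} (lookup Y (fromℕ T)) (In𝒳-fromℕ Y Y∈)) ⟩
      end-mass ∎
      where
      open ≡-Reasoning
      Y∈ : ∀ t → In𝒳 N T (suc S) (toℕ t) (lookup Y t)
      Y∈ = InΩ⇒In𝒳 Y∈Ω

      e : Config N → ℚ
      e x = P₂ (lookup Y (fromℕ T)) x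

      ∏K g : Family N T → ℚ
      ∏K X = ∏ℚ (λ t → reverse-kernel Y t (lookup X (inject₁ t)) (lookup X (suc t)))
      g X = ∏K X * e (lookup X (fromℕ T))

      Good : Fin (suc T) → Config N → Set
      Good t x = P₂ (lookup Y t) x ≢ 0ℚ

      weight≢0 : ∀ t x x′ → reverse-kernel Y t x x′ ≢ 0ℚ → P₂ (lookup Y (inject₁ t)) x * P₁ (toℕ t) x x′ ≢ 0ℚ
      weight≢0 t x x′ = *-≢0ˡ (P₂ (lookup Y (inject₁ t)) x * P₁ (toℕ t) x x′) (inv (D (toℕ t) (lookup Y (inject₁ t)) x′))

      steps : ∀ X → g X ≢ 0ℚ → ∀ t → Step (lookup X (inject₁ t)) (lookup X (suc t))
      steps X ≢0 t = P-t+-≢0⇒Step N T S (toℕ t) x x′ (*-≢0ʳ (P₂ (lookup Y (inject₁ t)) x) (P₁ (toℕ t) x x′)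
        (weight≢0 t x x′ (∏ℚ-≢0 (λ t → reverse-kernel Y t (lookup X (inject₁ t)) (lookup X (suc t)))
          (*-≢0ˡ (∏K X) (e (lookup X (fromℕ T))) ≢0) t)))
        where
        x x′ : Config N
        x  = lookup X (inject₁ t)
        x′ = lookup X (suc t)

      total : ∀ t {x′} → x′ ∈ 𝒳 N T S (suc (toℕ t)) → Good (suc t) x′ →
              ∑ (𝒳 N T S (toℕ t)) (λ x → reverse-kernel Y t x x′) ≡ 1ℚ
      total t {x′} x′∈ good = begin
        ∑ (𝒳 N T S (toℕ t)) (λ x → reverse-kernel Y t x x′)
          ≡⟨ ∑-*ʳ (𝒳 N T S (toℕ t)) (inv (D (toℕ t) y x′)) (λ x → P₂ y x * P₁ (toℕ t) x x′) ⟩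
        (P₂ ⟨ 𝒳 N T S (toℕ t) ⟩ P₁ (toℕ t)) y x′ * inv (D (toℕ t) y x′)
          ≡⟨ cong (_* inv (D (toℕ t) y x′)) (D-commute (toℕ t) (t<T t) y x′ y∈ x′∈′) ⟨
        D (toℕ t) y x′ * inv (D (toℕ t) y x′)
          ≡⟨ *-inv (>⇒≢0 (D-pos (toℕ t) (t<T t) y (lookup Y (suc t)) x′ y∈ (Y∈ (suc t)) x′∈′ (InΩ⇒Step Y∈Ω t) good)) ⟩
        1ℚ ∎
        where
        y : Config N
        y = lookup Y (inject₁ t)
        y∈ : In𝒳 N T (suc S) (toℕ t) y
        y∈ = In𝒳-inject₁ Y Y∈ t
        x′∈′ : In𝒳 N T S (suc (toℕ t)) x′
        x′∈′ = ∈𝒳⁻ N T S (suc (toℕ t)) x′∈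

      prev : ∀ t {x x′} → reverse-kernel Y t x x′ ≢ 0ℚ → Good (inject₁ t) x
      prev t {x} {x′} ≢0 = *-≢0ˡ (P₂ (lookup Y (inject₁ t)) x) (P₁ (toℕ t) x x′) (weight≢0 t x x′ ≢0)

    -- A detailed-balance identity. On the left the `P₂` entries at times 1, ..., T meet the one at
    -- time 0; on the right the same T + 1 entries are regrouped as 0, ..., T - 1 and T. The `P-t+`
    -- product along Y turns into a constant, while the constant for X is opened up into its
    -- factors, which enter the reverse kernel.
    reversal : ∀ X Y → InΩ N T S X → InΩ N T (suc S) Y →
      P-S↦S+1 N T S X Y * (weight N T S * P₂ base base) ≡
      weight N T (suc S) * (∏ℚ (λ t → reverse-kernel Y t (lookup X (inject₁ t)) (lookup X (suc t)))
                            * P₂ (lookup Y (fromℕ T)) (lookup X (fromℕ T)))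
    reversal X Y X∈ Y∈ = begin
      P-S↦S+1 N T S X Y * (weight N T S * P₂ base base)
        ≡⟨ cong₂ _*_ (P-product X Y X∈ Y∈) (cong₂ _*_ (sym (∏-P-t+ N T S X X∈))
             (cong₂ P₂ (sym (In𝒳-start {N} {T} {suc S} (lookup Y zero) (InΩ⇒In𝒳 Y∈ zero)))
                       (sym (In𝒳-start {N} {T} {S} (lookup X zero) (InΩ⇒In𝒳 X∈ zero))))) ⟩
      ∏ℚ (λ t → p⁺ t * a (suc t) * i t) * (∏ℚ p * a zero)
        ≡⟨ cong (_* (∏ℚ p * a zero))
             (trans (ℚ∏.∑-distrib-+ (λ t → p⁺ t * a (suc t)) i) (cong (_* ∏ℚ i) (ℚ∏.∑-distrib-+ p⁺ (a ∘ suc)))) ⟩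
      ∏ℚ p⁺ * ∏ℚ (a ∘ suc) * ∏ℚ i * (∏ℚ p * a zero)
        ≡⟨ solve 5 (λ p⁺ a i p a₀ → p⁺ :* a :* i :* (p :* a₀) := p⁺ :* ((a₀ :* a) :* (p :* i))) refl
             (∏ℚ p⁺) (∏ℚ (a ∘ suc)) (∏ℚ i) (∏ℚ p) (a zero) ⟩
      ∏ℚ p⁺ * (∏ℚ a * (∏ℚ p * ∏ℚ i))
        ≡⟨ cong₂ (λ u v → u * (v * (∏ℚ p * ∏ℚ i))) (∏-P-t+ N T (suc S) Y Y∈) (ℚ∏.sum-init-last a) ⟩
      weight N T (suc S) * (∏ℚ (a ∘ inject₁) * a (fromℕ T) * (∏ℚ p * ∏ℚ i))
        ≡⟨ cong (weight N T (suc S) *_) (solve 4 (λ a b c d → a :* b :* (c :* d) := (a :* c) :* d :* b) refl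
             (∏ℚ (a ∘ inject₁)) (a (fromℕ T)) (∏ℚ p) (∏ℚ i)) ⟩
      weight N T (suc S) * (∏ℚ (a ∘ inject₁) * ∏ℚ p * ∏ℚ i * a (fromℕ T))
        ≡⟨ cong (λ z → weight N T (suc S) * (z * a (fromℕ T)))
             (trans (ℚ∏.∑-distrib-+ (λ t → a (inject₁ t) * p t) i) (cong (_* ∏ℚ i) (ℚ∏.∑-distrib-+ (a ∘ inject₁) p))) ⟨
      weight N T (suc S) * (∏ℚ (λ t → a (inject₁ t) * p t * i t) * a (fromℕ T)) ∎
      where
      open ≡-Reasoning
      p p⁺ i : Fin T → ℚ
      p  t = P₁ (toℕ t) (lookup X (inject₁ t)) (lookup X (suc t))
      p⁺ t = P₁⁺ (toℕ t) (lookup Y (inject₁ t)) (lookup Y (suc t))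
      i  t = inv (D (toℕ t) (lookup Y (inject₁ t)) (lookup X (suc t)))
      a : Fin (suc T) → ℚ
      a t = P₂ (lookup Y t) (lookup X t)

    ratio : ℚ
    ratio = weight N T (suc S) * end-mass * inv (weight N T S * P₂ base base)

    ratio-pos : 0ℚ ℚ.< ratio
    ratio-pos = *-pos (*-pos (weight-pos N T (suc S)) end-mass-pos) (inv-pos (*-pos (weight-pos N T S) P₂-base))

    column-sum : ∀ Y → InΩ N T (suc S) Y → ∑ (Ω N T S) (λ X → P-S↦S+1 N T S X Y) ≡ ratio
    column-sum Y Y∈ = *-cancelˡ c≢0 (begin
      c * ∑ (Ω N T S) (λ X → P-S↦S+1 N T S X Y)
        ≡⟨ ℚ.*-comm c _ ⟩
      ∑ (Ω N T S) (λ X → P-S↦S+1 N T S X Y) * c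
        ≡⟨ ∑-*ʳ (Ω N T S) c (λ X → P-S↦S+1 N T S X Y) ⟨
      ∑ (Ω N T S) (λ X → P-S↦S+1 N T S X Y * c)
        ≡⟨ ∑-cong (Ω N T S) (λ {X} X∈ → reversal X Y (∈Ω⁻ N T S X∈) Y∈) ⟩
      ∑ (Ω N T S) (λ X → weight N T (suc S) * g X)
        ≡⟨ ∑-*ˡ (Ω N T S) (weight N T (suc S)) g ⟩
      weight N T (suc S) * ∑ (Ω N T S) g
        ≡⟨ cong (weight N T (suc S) *_) (∑-reverse-kernel Y Y∈) ⟩
      weight N T (suc S) * end-mass
        ≡⟨ one* (*-inv c≢0) (weight N T (suc S) * end-mass) ⟨
      c * inv c * (weight N T (suc S) * end-mass)
        ≡⟨ solve 3 (λ a b c → a :* b :* c := a :* (c :* b)) refl c (inv c) (weight N T (suc S) * end-mass) ⟩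
      c * ratio ∎)
      where
      open ≡-Reasoning
      c : ℚ
      c = weight N T S * P₂ base base
      c≢0 : c ≢ 0ℚ
      c≢0 = >⇒≢0 (*-pos (weight-pos N T S) P₂-base)
      g : Family N T → ℚ
      g X = ∏ℚ (λ t → reverse-kernel Y t (lookup X (inject₁ t)) (lookup X (suc t)))
            * P₂ (lookup Y (fromℕ T)) (lookup X (fromℕ T))

    cardinality-ratio : fromℤ (+ length (Ω N T S)) ≡ ratio * fromℤ (+ length (Ω N T (suc S)))
    cardinality-ratio = begin
      fromℤ (+ length (Ω N T S))      ≡⟨ ∑-1 (Ω N T S) ⟨
      ∑ (Ω N T S) (λ _ → 1ℚ)          ≡⟨ ∑-cong (Ω N T S) (λ {X} X∈ → row-sum X (∈Ω⁻ N T S X∈)) ⟨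
      ∑ (Ω N T S) (λ X → ∑ (Ω N T (suc S)) (P-S↦S+1 N T S X))
        ≡⟨ ∑-swap (Ω N T S) (Ω N T (suc S)) (P-S↦S+1 N T S) ⟩
      ∑ (Ω N T (suc S)) (λ Y → ∑ (Ω N T S) (λ X → P-S↦S+1 N T S X Y))
        ≡⟨ ∑-cong (Ω N T (suc S)) (λ {Y} Y∈ → trans (column-sum Y (∈Ω⁻ N T (suc S) Y∈)) (sym (ℚ.*-identityʳ ratio))) ⟩
      ∑ (Ω N T (suc S)) (λ _ → ratio * 1ℚ) ≡⟨ ∑-*ˡ (Ω N T (suc S)) ratio (λ _ → 1ℚ) ⟩
      ratio * ∑ (Ω N T (suc S)) (λ _ → 1ℚ) ≡⟨ cong (ratio *_) (∑-1 (Ω N T (suc S))) ⟩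
      ratio * fromℤ (+ length (Ω N T (suc S))) ∎
      where open ≡-Reasoning

    μ-uniform : ∀ S {X} → InΩ N T S X → μ N T S X ≡ inv (fromℤ (+ length (Ω N T S)))
    μ-uniform S {X} X∈ = if-dec (inΩ? N T S X) (λ _ → refl) (λ X∉ → contradiction X∈ X∉)

  uniform-preserved : ∀ Y → InΩ N T (suc S) Y →
    μ N T (suc S) Y ≡ ∑ (Ω N T S) (λ X → P-S↦S+1 N T S X Y * μ N T S X)
  uniform-preserved Y Y∈ = sym (begin
    ∑ (Ω N T S) (λ X → P-S↦S+1 N T S X Y * μ N T S X)
      ≡⟨ ∑-cong (Ω N T S) (λ {X} X∈ → cong (P-S↦S+1 N T S X Y *_) (μ-uniform S (∈Ω⁻ N T S X∈))) ⟩
    ∑ (Ω N T S) (λ X → P-S↦S+1 N T S X Y * inv m)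
      ≡⟨ ∑-*ʳ (Ω N T S) (inv m) (λ X → P-S↦S+1 N T S X Y) ⟩
    ∑ (Ω N T S) (λ X → P-S↦S+1 N T S X Y) * inv m
      ≡⟨ cong₂ _*_ (column-sum Y Y∈) (trans (cong inv cardinality-ratio) (inv-* (>⇒≢0 ratio-pos) n≢0)) ⟩
    ratio * (inv ratio * inv n)
      ≡⟨ ℚ.*-assoc ratio (inv ratio) (inv n) ⟨
    ratio * inv ratio * inv n
      ≡⟨ one* (*-inv (>⇒≢0 ratio-pos)) (inv n) ⟩
    inv n
      ≡⟨ μ-uniform (suc S) Y∈ ⟨
    μ N T (suc S) Y ∎)
    where
    open ≡-Reasoning
    m n : ℚ
    m = fromℤ (+ length (Ω N T S))
    n = fromℤ (+ length (Ω N T (suc S)))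
    n≢0 : n ≢ 0ℚ
    n≢0 = subst (_≢ 0ℚ) (∑-1 (Ω N T (suc S)))
      (>⇒≢0 (∑-pos (Ω N T (suc S)) (λ _ → ℚ.<⇒≤ (ℚ.positive⁻¹ 1ℚ)) (∈Ω⁺ N T (suc S) Y∈) (ℚ.positive⁻¹ 1ℚ)))

theorem3p1 : (N T S : ℕ) → 1 ≤ N → 1 ≤ T → S < T →
    (∀ X Y → InΩ N T S X → InΩ N T (suc S) Y → 0ℚ ≤ℚ P-S↦S+1 N T S X Y) ×
    (∀ X → InΩ N T S X → ∑ (Ω N T (suc S)) (λ Y → P-S↦S+1 N T S X Y) ≡ 1ℚ) ×
    (∀ Y → InΩ N T (suc S) Y →
    μ N T (suc S) Y ≡ ∑ (Ω N T S) (λ X → P-S↦S+1 N T S X Y * μ N T S X))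
theorem3p1 N T S _ _ S<T = P-nonneg N T S S<T , row-sum N T S S<T , uniform-preserved N T S S<T
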